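{- Let $\delta\in(0,1/2)$. Assume that $M,N\colon G\to\mathbb C$ satisfy $\Psi_M\Psi_{N,N}\ne0$ and $\beta(M)\ge\beta(N)>0$. Consider the following conclusion. (C) For $\alpha\in\mathbb C$, the maximum of $\beta(M+\alpha N)$ occurs for $$\alpha=\alpha_1:=\frac{\overline{\Psi_M}\Psi_{M,N}-\overline{\Psi_N}\Psi_{M,M}}{\overline{\Psi_N}\,\overline{\Psi_{M,N}}-\overline{\Psi_M}\Psi_{N,N}}$$ and is $$\beta(M+\alpha_1N)=\frac{|\Psi_N|^2\Psi_{M,M}+|\Psi_M|^2\Psi_{N,N}-2\mathrm{Re}(\overline{\Psi_M}\Psi_N\Psi_{M,N})}{\Psi_{M,M}\Psi_{N,N}-|\Psi_{M,N}|^2}=\beta(M)+\frac{|\overline{\Psi_M}\Psi_{M,N}-\overline{\Psi_N}\Psi_{M,M}|^2}{\Psi_{M,M}(\Psi_{M,M}\Psi_{N,N}-|\Psi_{M,N}|^2)},$$ the denominators in these expressions for $\beta(M+\alpha_1N)$ being positive. Then the following hold. (i) Assume that $$|\overline{\Psi_M}\Psi_{M,N}-\overline{\Psi_N}\Psi_{M,M}|\ge\delta^2\,|\Psi_N|\Psi_{M,M}.$$ Then (C) holds, and furthermore $\beta(M+\alpha_1N)-\beta(M)\ge\delta^4\beta(N)$. (ii) Assume that $$|\overline{\Psi_M}\Psi_{M,N}-\overline{\Psi_N}\Psi_{M,M}|<\delta^2\,|\Psi_N|\Psi_{M,M}\quad\text{and}\quad|\Psi_N\Psi_{M,N}-\Psi_M\Psi_{N,N}|\ge\delta\,\Psi_{N,N}|\Psi_M|.$$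 Then (C) holds, and furthermore $$\beta(M+\alpha N)-\beta(M)\le\delta^2\frac{\beta(N)}{\beta(M)}\le\delta^2\quad\text{for every }\alpha\in\mathbb C.$$
   Context: $G$ is an (indexing) set, $L\colon G\to\mathbb C$ is a function, and $w\colon G\to[0,\infty)$ is a weight function, not identically $0$. For $f\colon G\to\mathbb C$ put $\mathbb E^w_{\pi\in G}f(\pi):=\frac{\sum_{\pi\in G}w(\pi)f(\pi)}{\sum_{\pi\in G}w(\pi)}$. For $M,N\colon G\to\mathbb C$ define $\Psi_M:=\mathbb E^w_{\pi\in G}L(\pi)M(\pi)$, $\Psi_{M,N}:=\mathbb E^w_{\pi\in G}L(\pi)M(\pi)\overline{L(\pi)N(\pi)}$, and $\beta(M):=|\Psi_M|^2/\Psi_{M,M}$ if $\Psi_{M,M}\ne0$, $\beta(M):=0$ if $\Psi_{M,M}=0$. It is assumed that the series $\sum_\pi w(\pi)$ and $\sum_\pi w(\pi)|L(\pi)M(\pi)|^2$ converge for every function $M$ considered (automatic if $G$ is finite). -}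

module Defs where

open import Algebra.Bundles using (CommutativeRing)
open import Axiom.ExcludedMiddle using (ExcludedMiddle)
open import Data.Bool.Base using (if_then_else_)
open import Data.List.Base using (List; foldr)
open import Data.List.Relation.Binary.Subset.Propositional using (_⊆_)
open import Data.List.Relation.Unary.Unique.Propositional using (Unique)
open import Data.Product using (∃; ∃-syntax; _×_; _,_; proj₁; proj₂)
open import Data.Sum.Base using (inj₁; inj₂)
open import Function.Base using (case_of_)
open import Level using (0ℓ)
open import Relation.Binary.Core using (Rel)
open import Relation.Binary.Structures using (IsTotalOrder)
open import Relation.Nullary using (¬_; yes; no; does)
open import Relation.Unary using (Pred; Satisfiable)

-- The standard library has no real numbers, so ℝ is taken to be an arbitrary
-- Dedekind-complete totally ordered field.  Equality is a setoid equality.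
record CompleteOrderedField : Set₁ where
  infix 4 _≤_
  field
    commutativeRing : CommutativeRing 0ℓ 0ℓ
  open CommutativeRing commutativeRing public renaming (Carrier to ℝ)
  field
    _≤_             : Rel ℝ 0ℓ
    ≤-isTotalOrder  : IsTotalOrder _≈_ _≤_
    +-monoˡ-≤       : ∀ z {x y} → x ≤ y → x + z ≤ y + z
    *-nonneg        : ∀ {x y} → 0# ≤ x → 0# ≤ y → 0# ≤ x * y
    0≉1             : ¬ (0# ≈ 1#)
    inverse         : ∀ x → ¬ (x ≈ 0#) → ∃[ y ] x * y ≈ 1#

  IsUpperBound : Pred ℝ 0ℓ → ℝ → Set
  IsUpperBound P b = ∀ x → P x → x ≤ b

  field
    complete : ∀ (P : Pred ℝ 0ℓ) → Satisfiable P → ∃ (IsUpperBound P) →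
               ∃[ s ] IsUpperBound P s × (∀ b → IsUpperBound P b → s ≤ b)

  open import Relation.Binary.Construct.NonStrictToStrict _≈_ _≤_ public using (_<_)
  open import Algebra.Properties.Semiring.Exp semiring public using (_^_)

-- The mathematics is classical, whence the assumption of excluded middle.
module Complex (em : ExcludedMiddle 0ℓ) (𝓡 : CompleteOrderedField) where

  open CompleteOrderedField 𝓡 public

  module SquareRoot where
    open IsTotalOrder ≤-isTotalOrder using (total; antisym)
      renaming (trans to ≤-trans; reflexive to ≤-reflexive; refl to ≤-refl)
    open import Algebra.Properties.Ring ring
      using (-‿distribˡ-*; -‿distribʳ-*)
    open import Algebra.Properties.Group +-group using (⁻¹-involutive; ∙-cancelˡ)
    open import Algebra.Solver.Ring.NaturalCoefficients.Default commutativeSemiring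
      using (solve; _:=_; _:+_; _:*_)

    private
      ≤-resp : ∀ {x x′ y y′} → x ≈ x′ → y ≈ y′ → x ≤ y → x′ ≤ y′
      ≤-resp p q x≤y = ≤-trans (≤-reflexive (sym p)) (≤-trans x≤y (≤-reflexive q))

      +-monoʳ-≤ : ∀ z {x y} → x ≤ y → z + x ≤ z + y
      +-monoʳ-≤ z x≤y = ≤-resp (+-comm _ z) (+-comm _ z) (+-monoˡ-≤ z x≤y)

      x≤x+d : ∀ x {d} → 0# ≤ d → x ≤ x + d
      x≤x+d x 0≤d = ≤-resp (+-identityʳ x) refl (+-monoʳ-≤ x 0≤d)

      +-nonneg : ∀ {x y} → 0# ≤ x → 0# ≤ y → 0# ≤ x + y
      +-nonneg {x} 0≤x 0≤y = ≤-trans 0≤x (x≤x+d x 0≤y)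

      difference : ∀ {x y} → x ≤ y → ∃[ d ] 0# ≤ d × x + d ≈ y
      difference {x} {y} x≤y = y - x
        , ≤-resp (-‿inverseʳ x) refl (+-monoˡ-≤ (- x) x≤y)
        , trans (+-comm x (y - x))
            (trans (+-assoc y (- x) x)
              (trans (+-congˡ (-‿inverseˡ x)) (+-identityʳ y)))

      x+d≤x⇒d≤0 : ∀ {x d} → x + d ≤ x → d ≤ 0#
      x+d≤x⇒d≤0 {x} {d} h = ≤-resp
        (trans (+-comm (x + d) (- x)) (trans (sym (+-assoc (- x) x d))
          (trans (+-congʳ (-‿inverseˡ x)) (+-identityˡ d))))
        (-‿inverseʳ x)
        (+-monoˡ-≤ (- x) h)

      *-monoʳ-≤ : ∀ {z x y} → 0# ≤ z → x ≤ y → z * x ≤ z * y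
      *-monoʳ-≤ {z} {x} {y} 0≤z x≤y with difference x≤y
      ... | d , 0≤d , x+d≈y =
        ≤-resp refl (trans (sym (distribˡ z x d)) (*-congˡ x+d≈y))
          (x≤x+d (z * x) (*-nonneg 0≤z 0≤d))

      -x*-x≈x*x : ∀ x → - x * - x ≈ x * x
      -x*-x≈x*x x = trans (sym (-‿distribˡ-* x (- x)))
        (trans (-‿cong (sym (-‿distribʳ-* x x))) (⁻¹-involutive (x * x)))

    x*x-nonneg : ∀ x → 0# ≤ x * x
    x*x-nonneg x with total 0# x
    ... | inj₁ 0≤x = *-nonneg 0≤x 0≤x
    ... | inj₂ x≤0 = ≤-resp refl (-x*-x≈x*x x) (*-nonneg 0≤-x 0≤-x)
      where
      0≤-x : 0# ≤ - x
      0≤-x = ≤-resp (-‿inverseʳ x) (+-identityˡ (- x)) (+-monoˡ-≤ (- x) x≤0)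

    private
      0≤1 : 0# ≤ 1#
      0≤1 = ≤-resp refl (*-identityˡ 1#) (x*x-nonneg 1#)

      inverse-nonneg : ∀ {x i} → 0# ≤ x → x * i ≈ 1# → 0# ≤ i
      inverse-nonneg {x} {i} 0≤x xi≈1 = ≤-resp refl
        (trans (*-comm (i * i) x)
          (trans (sym (*-assoc x i i)) (trans (*-congʳ xi≈1) (*-identityˡ i))))
        (*-nonneg (x*x-nonneg i) 0≤x)

      x*x≈0⇒x≈0 : ∀ {x} → x * x ≈ 0# → x ≈ 0#
      x*x≈0⇒x≈0 {x} xx≈0 with em {x ≈ 0#}
      ... | yes x≈0 = x≈0
      ... | no  x≉0 with inverse x x≉0
      ...   | i , xi≈1 =
        trans (sym (*-identityʳ x)) (trans (*-congˡ (sym xi≈1))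
          (trans (sym (*-assoc x x i)) (trans (*-congʳ xx≈0) (zeroˡ i))))

      square-cancel-≤ : ∀ {x y} → 0# ≤ y → x * x ≤ y * y → x ≤ y
      square-cancel-≤ {x} {y} 0≤y xx≤yy with total x y
      ... | inj₁ x≤y = x≤y
      ... | inj₂ y≤x with difference y≤x
      ...   | d , 0≤d , y+d≈x =
        ≤-reflexive (trans (sym y+d≈x) (trans (+-congˡ d≈0) (+-identityʳ y)))
        where
        expand : x * x ≈ y * y + (d * d + (y * d + y * d))
        expand = trans (*-cong (sym y+d≈x) (sym y+d≈x))
          (solve 2 (λ y d → (y :+ d) :* (y :+ d)
                         := y :* y :+ (d :* d :+ (y :* d :+ y :* d))) refl y d)

        dd≤0 : d * d ≤ 0#
        dd≤0 = ≤-trans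
          (x≤x+d (d * d) (+-nonneg (*-nonneg 0≤y 0≤d) (*-nonneg 0≤y 0≤d)))
          (x+d≤x⇒d≤0 (≤-resp expand refl xx≤yy))

        d≈0 : d ≈ 0#
        d≈0 = x*x≈0⇒x≈0 (antisym dd≤0 (x*x-nonneg d))

      root-below : ∀ {a s} → 0# ≤ s → IsUpperBound (λ x → x * x ≤ a) s →
                   s * s ≤ a → s * s ≈ a
      root-below {a} {s} 0≤s upper ss≤a with difference ss≤a
      ... | d , 0≤d , ss+d≈a = trans (sym (+-identityʳ (s * s)))
                                 (trans (+-congˡ (sym d≈0)) ss+d≈a)
        where
        0≤2s : 0# ≤ s + s
        0≤2s = +-nonneg 0≤s 0≤s

        1≤q : 1# ≤ (1# + d) + (s + s)
        1≤q = ≤-trans (x≤x+d 1# 0≤d) (x≤x+d (1# + d) 0≤2s)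

        q≉0 : ¬ ((1# + d) + (s + s) ≈ 0#)
        q≉0 q≈0 = 0≉1 (antisym 0≤1 (≤-resp refl q≈0 1≤q))

        d≤q : d ≤ (1# + d) + (s + s)
        d≤q = ≤-trans (≤-resp refl (+-comm d 1#) (x≤x+d d 0≤1)) (x≤x+d (1# + d) 0≤2s)

        step : ∀ {q i} → q ≈ (1# + d) + (s + s) → q * i ≈ 1# → d ≈ 0#
        step {q} {i} q≈ qi≈1 = trans (sym eq≈d) (trans (*-congʳ e≈0) (zeroˡ q))
          where
          0≤i : 0# ≤ i
          0≤i = inverse-nonneg (≤-resp refl (sym q≈) (≤-trans 0≤1 1≤q)) qi≈1

          0≤e : 0# ≤ i * d
          0≤e = *-nonneg 0≤i 0≤d

          eq≈d : i * d * q ≈ d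
          eq≈d = trans (*-comm (i * d) q)
            (trans (sym (*-assoc q i d)) (trans (*-congʳ qi≈1) (*-identityˡ d)))

          e≤1+d : i * d ≤ 1# + d
          e≤1+d = ≤-trans
            (≤-resp refl (trans (*-comm i q) qi≈1)
              (*-monoʳ-≤ 0≤i (≤-resp refl (sym q≈) d≤q)))
            (x≤x+d 1# 0≤d)

          below-a : ∀ {e} → 0# ≤ e → e ≤ 1# + d → e * q ≈ d → (s + e) * (s + e) ≤ a
          below-a {e} 0≤e e≤1+d eq≈d = ≤-resp
            (solve 2 (λ s e → s :* s :+ e :* (e :+ (s :+ s))
                           := (s :+ e) :* (s :+ e)) refl s e)
            (trans (+-congˡ (trans (*-congˡ (sym q≈)) eq≈d)) ss+d≈a)
            (+-monoʳ-≤ (s * s) (*-monoʳ-≤ 0≤e (+-monoˡ-≤ (s + s) e≤1+d)))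

          e≈0 : i * d ≈ 0#
          e≈0 = antisym (x+d≤x⇒d≤0 (upper (s + i * d) (below-a 0≤e e≤1+d eq≈d))) 0≤e

        d≈0 : d ≈ 0#
        d≈0 with inverse _ q≉0
        ... | i , qi≈1 = step refl qi≈1

      root-above : ∀ {a s} → 0# ≤ a → 0# ≤ s →
                   (∀ t → IsUpperBound (λ x → x * x ≤ a) t → s ≤ t) →
                   a ≤ s * s → s * s ≈ a
      root-above {a} {s} 0≤a 0≤s least a≤ss with em {s ≈ 0#}
      ... | yes s≈0 =
        antisym (≤-trans (≤-reflexive (trans (*-congʳ s≈0) (zeroˡ s))) 0≤a) a≤ss
      ... | no  s≉0 with difference a≤ss
      ...   | d , 0≤d , a+d≈ss =
        trans (sym a+d≈ss) (trans (+-congˡ d≈0) (+-identityʳ a))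
        where
        2s≉0 : ¬ (s + s ≈ 0#)
        2s≉0 2s≈0 = s≉0 (antisym (≤-resp refl 2s≈0 (x≤x+d s 0≤s)) 0≤s)

        a+ee≈tt : ∀ {e t} → t + e ≈ s → e * (s + s) ≈ d → a + e * e ≈ t * t
        a+ee≈tt {e} {t} t+e≈s e2s≈d = ∙-cancelˡ ((t * e + t * e) + e * e) _ _ (trans
          (solve 3 (λ a t e → (t :* e :+ t :* e :+ e :* e) :+ (a :+ e :* e)
                           := a :+ e :* (t :+ e :+ (t :+ e))) refl a t e)
          (trans (+-congˡ (trans (*-congˡ (+-cong t+e≈s t+e≈s)) e2s≈d))
            (trans a+d≈ss (trans (*-cong (sym t+e≈s) (sym t+e≈s))
              (solve 2 (λ t e → (t :+ e) :* (t :+ e)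
                             := (t :* e :+ t :* e :+ e :* e) :+ t :* t) refl t e)))))

        step : ∀ {e t} → 0# ≤ e → 0# ≤ t → t + e ≈ s → e * (s + s) ≈ d → d ≈ 0#
        step {e} {t} 0≤e 0≤t t+e≈s e2s≈d =
          trans (sym e2s≈d) (trans (*-congʳ e≈0) (zeroˡ (s + s)))
          where
          t-bound : IsUpperBound (λ x → x * x ≤ a) t
          t-bound x xx≤a = square-cancel-≤ 0≤t (≤-trans xx≤a
            (≤-resp refl (a+ee≈tt t+e≈s e2s≈d) (x≤x+d a (x*x-nonneg e))))

          e≈0 : e ≈ 0#
          e≈0 = antisym
            (x+d≤x⇒d≤0 (≤-trans (≤-reflexive t+e≈s) (least t t-bound))) 0≤e

        d≈0 : d ≈ 0#
        d≈0 with inverse _ 2s≉0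
        ... | i , 2si≈1 = step {i * d} {i * (s * s + a)}
          (*-nonneg 0≤i 0≤d)
          (*-nonneg 0≤i (+-nonneg (x*x-nonneg s) 0≤a))
          (trans
            (solve 4 (λ i s a d → i :* (s :* s :+ a) :+ i :* d
                               := i :* (s :* s :+ (a :+ d))) refl i s a d)
            (trans (*-congˡ (+-congˡ a+d≈ss))
              (trans (solve 2 (λ i s → i :* (s :* s :+ s :* s)
                                    := (s :+ s) :* i :* s) refl i s)
                (trans (*-congʳ 2si≈1) (*-identityˡ s)))))
          (trans
            (solve 3 (λ i d s → i :* d :* (s :+ s) := (s :+ s) :* i :* d) refl i d s)
            (trans (*-congʳ 2si≈1) (*-identityˡ d)))
          where
          0≤i : 0# ≤ i
          0≤i = inverse-nonneg (+-nonneg 0≤s 0≤s) 2si≈1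

    -- The root is the supremum of { x | x * x ≤ a }.
    -- Abstract: its type determines the root up to _≈_, and unfolding is expensive.
    abstract
      sqrt : ∀ a → 0# ≤ a → ∃[ y ] 0# ≤ y × y * y ≈ a
      sqrt a 0≤a with complete (λ x → x * x ≤ a) (0# , 0∈P) (1# + a , bound)
        where
        0∈P : 0# * 0# ≤ a
        0∈P = ≤-resp (sym (zeroˡ 0#)) refl 0≤a

        0≤1+a : 0# ≤ 1# + a
        0≤1+a = +-nonneg 0≤1 0≤a

        a≤[1+a]² : a ≤ (1# + a) * (1# + a)
        a≤[1+a]² = ≤-trans (≤-resp refl (+-comm a 1#) (x≤x+d a 0≤1))
          (≤-resp (*-identityʳ (1# + a)) refl (*-monoʳ-≤ 0≤1+a (x≤x+d 1# 0≤a)))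

        bound : IsUpperBound (λ x → x * x ≤ a) (1# + a)
        bound x xx≤a = square-cancel-≤ 0≤1+a (≤-trans xx≤a a≤[1+a]²)
      ... | s , upper , least = s , 0≤s , ss≈a
        where
        0≤s : 0# ≤ s
        0≤s = upper 0# (≤-resp (sym (zeroˡ 0#)) refl 0≤a)

        ss≈a : s * s ≈ a
        ss≈a with total (s * s) a
        ... | inj₁ ss≤a = root-below 0≤s upper ss≤a
        ... | inj₂ a≤ss = root-above 0≤a 0≤s least a≤ss

    +-squares-nonneg : ∀ x y → 0# ≤ x * x + y * y
    +-squares-nonneg x y = +-nonneg (x*x-nonneg x) (x*x-nonneg y)

  -- x / 0# is 0#; every division below is either by a quantity that is nonzero
  -- under the standing hypotheses or is accompanied by a nonvanishing claim.
  infix 8 _⁻¹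
  _⁻¹ : ℝ → ℝ
  x ⁻¹ = case em {x ≈ 0#} of λ where
    (yes _)   → 0#
    (no  x≉0) → proj₁ (inverse x x≉0)

  infixl 7 _/_
  _/_ : ℝ → ℝ → ℝ
  x / y = x * y ⁻¹

  record ℂ : Set where
    constructor _+i_
    field
      re im : ℝ
  open ℂ public

  infix 4 _≈ᶜ_
  _≈ᶜ_ : Rel ℂ 0ℓ
  z ≈ᶜ u = re z ≈ re u × im z ≈ im u

  ofReal : ℝ → ℂ
  ofReal x = x +i 0#

  0ᶜ : ℂ
  0ᶜ = ofReal 0#

  infixl 6 _+ᶜ_ _-ᶜ_
  infixl 7 _*ᶜ_ _/ᶜ_

  _+ᶜ_ _-ᶜ_ _*ᶜ_ _/ᶜ_ : ℂ → ℂ → ℂ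
  z +ᶜ u = (re z + re u) +i (im z + im u)
  z -ᶜ u = (re z - re u) +i (im z - im u)
  z *ᶜ u = (re z * re u - im z * im u) +i (re z * im u + im z * re u)

  normSq : ℂ → ℝ
  normSq z = re z * re z + im z * im z

  conj : ℂ → ℂ
  conj z = re z +i (- im z)

  z /ᶜ u = z *ᶜ (conj u *ᶜ ofReal (normSq u ⁻¹))

  ∣_∣ : ℂ → ℝ
  ∣ z ∣ = proj₁ (SquareRoot.sqrt (normSq z) (SquareRoot.+-squares-nonneg (re z) (im z)))

  module _ {G : Set} where

    partialSum : (G → ℂ) → List G → ℂ
    partialSum f = foldr (λ π s → f π +ᶜ s) 0ᶜ

    -- Unconditional convergence: a duplicate-free list is a finite subset of G,
    -- and the limit is taken along the finite subsets ordered by inclusion.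
    HasSum : (G → ℂ) → ℂ → Set
    HasSum f s = ∀ ε → 0# < ε →
      ∃[ F ] (∀ F′ → Unique F′ → F ⊆ F′ → ∣ partialSum f F′ -ᶜ s ∣ < ε)

    Summable : (G → ℂ) → Set
    Summable f = ∃ (HasSum f)

    -- Equal to 0 by convention for a family that is not summable.
    ∑ : (G → ℂ) → ℂ
    ∑ f = case em {Summable f} of λ where
      (yes (s , _)) → s
      (no  _)       → 0ᶜ

  module Weighted {G : Set} (w : G → ℝ) (L : G → ℂ) where

    -- Opaque only to keep normal forms small; a proof can unfold it.
    opaque
      𝔼 : (G → ℂ) → ℂ
      𝔼 f = ∑ (λ π → ofReal (w π) *ᶜ f π) /ᶜ ∑ (λ π → ofReal (w π))

    Ψ₁ : (G → ℂ) → ℂ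
    Ψ₁ M = 𝔼 (λ π → L π *ᶜ M π)

    Ψ₂ : (G → ℂ) → (G → ℂ) → ℂ
    Ψ₂ M N = 𝔼 (λ π → (L π *ᶜ M π) *ᶜ conj (L π *ᶜ N π))

    -- Ψ₂ M M is a real number as an element of ℂ; this is the same number in ℝ,
    -- needed where it is compared with other reals.
    Ψᵣ : (G → ℂ) → ℝ
    Ψᵣ M = re (Ψ₂ M M)

    β : (G → ℂ) → ℝ
    β M = if does (em {Ψ₂ M M ≈ᶜ 0ᶜ}) then 0# else ∣ Ψ₁ M ∣ ^ 2 / Ψᵣ M

    SquareSummable : (G → ℂ) → Set
    SquareSummable M = Summable (λ π → ofReal (w π * ∣ L π *ᶜ M π ∣ ^ 2))

    infixl 6 _⊕_·_
    _⊕_·_ : (G → ℂ) → ℂ → (G → ℂ) → (G → ℂ)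
    (M ⊕ α · N) π = M π +ᶜ α *ᶜ N π

    module Maximum (M N : G → ℂ) where

      numerator denominator α₁ : ℂ
      numerator   = conj (Ψ₁ M) *ᶜ Ψ₂ M N -ᶜ conj (Ψ₁ N) *ᶜ Ψ₂ M M
      denominator = conj (Ψ₁ N) *ᶜ conj (Ψ₂ M N) -ᶜ conj (Ψ₁ M) *ᶜ Ψ₂ N N
      α₁          = numerator /ᶜ denominator

      gram : ℝ
      gram = Ψᵣ M * Ψᵣ N - ∣ Ψ₂ M N ∣ ^ 2

      Conclusion : Set
      Conclusion =
        ¬ (denominator ≈ᶜ 0ᶜ) ×
        (∀ α → β (M ⊕ α · N) ≤ β (M ⊕ α₁ · N)) ×
        0# < gram ×
        0# < Ψᵣ M * gram ×
        β (M ⊕ α₁ · N) ≈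
          (∣ Ψ₁ N ∣ ^ 2 * Ψᵣ M + ∣ Ψ₁ M ∣ ^ 2 * Ψᵣ N
            - (1# + 1#) * re (conj (Ψ₁ M) *ᶜ Ψ₁ N *ᶜ Ψ₂ M N)) / gram ×
        β (M ⊕ α₁ · N) ≈ β M + ∣ numerator ∣ ^ 2 / (Ψᵣ M * gram)

{-# OPTIONS --safe #-}
-- Write u = L M and v = L N, with inner product ⟨x, y⟩ = 𝔼 x ȳ, so that the constant 1
-- is a unit vector, Ψ_M = ⟨u, 1⟩ and Ψ_{M,N} = ⟨u, v⟩.  Then β(M + αN) is the squared
-- length of the projection of 1 onto the line through u + αv, hence at most the squared
-- length V of its projection e onto span(u, v); the Gram determinant of e and u + αv is
-- the nonnegative quantity |α · denominator − numerator|² / gram, which vanishes exactly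
-- at α₁.  The gains over β(M) and β(N) are V − β(M) = |numerator|² / (Ψ_{M,M} · gram) and
-- V − β(N) = |denominator|² / (Ψ_{N,N} · gram).  Cauchy–Schwarz for 1 and the component of
-- u orthogonal to v gives |denominator|² ≤ Ψ_{N,N} · gram.  This turns the lower bound on
-- |denominator| in (ii) into a lower bound on gram, and in (i) it excludes gram = 0, as
-- then denominator = 0 and both gains force numerator = 0.  In (i), denominator = 0 would
-- give V = β(N) ≤ β(M) < V.
module Submission where

open import Algebra.Bundles using (CommutativeRing)
open import Axiom.ExcludedMiddle using (ExcludedMiddle)
open import Data.Integer.Base as ℤ using (ℤ; +_; -[1+_]; _⊖_; _◃_)
open import Data.List.Base using (List; []; _∷_; _++_; foldr; deduplicate)
open import Data.List.Membership.Propositional.Properties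
  using (∈-∃++; ∈-++⁺ˡ; ∈-++⁺ʳ; ∈-++⁻; ∈-deduplicate⁺)
open import Data.List.Relation.Binary.Subset.Propositional using (_⊆_)
import Data.List.Relation.Unary.All as All
open import Data.List.Relation.Unary.AllPairs using ([]; _∷_)
open import Data.List.Relation.Unary.Any using (here; there)
open import Data.List.Relation.Unary.Unique.DecPropositional.Properties using (deduplicate-!)
open import Data.List.Relation.Unary.Unique.Propositional using (Unique)
open import Data.Nat.Base as ℕ using (ℕ; zero; suc)
open import Data.Product using (∃; ∃-syntax; _×_; _,_; proj₁; proj₂)
open import Data.Sum.Base using (inj₁; inj₂)
open import Defs
open import Function.Base using (_∘_)
open import Level using (0ℓ)
open import Relation.Binary.Bundles using (Poset)
open import Relation.Binary.PropositionalEquality.Core as ≡ using (_≡_)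
open import Relation.Binary.Structures using (IsTotalOrder)
open import Relation.Nullary using (¬_; yes; no; contradiction)

-- Ring normalisation with integer coefficients over an arbitrary commutative ring.

module IntegerRingSolver (R : CommutativeRing 0ℓ 0ℓ) where

  open CommutativeRing R
  open import Algebra.Properties.AbelianGroup +-abelianGroup using (⁻¹-∙-comm)
  open import Algebra.Properties.Group +-group using (⁻¹-involutive; ε⁻¹≈ε)
  open import Algebra.Properties.Ring ring using (-‿distribˡ-*; -‿distribʳ-*)
  open import Algebra.Properties.CommutativeSemigroup +-commutativeSemigroup
    using (interchange)
  open import Algebra.Properties.Semiring.Mult.TCOptimised semiring
    using (×-homo-+; ×1-homo-*)
    renaming (_×_ to _·_)
  open import Algebra.Solver.Ring.AlmostCommutativeRing
    using (_-Raw-AlmostCommutative⟶_; fromCommutativeRing)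
  open import Data.Integer.Properties using ([1+m]⊖[1+n]≡m⊖n)
    renaming (_≟_ to _ℤ≟_)
  open import Data.Maybe.Base using (Maybe; just; nothing)
  import Data.Sign.Base as Sign
  open import Relation.Binary.Reasoning.Setoid setoid

  -- With the optimised multiple, `fromℕ 1` and `fromℕ 2` unfold to `1#` and `1# + 1#`, so that
  -- `con (+ 2)` in a solver call matches a literal `1# + 1#`.
  fromℕ : ℕ → Carrier
  fromℕ n = n · 1#

  fromℤ : ℤ → Carrier
  fromℤ (+ n)    = fromℕ n
  fromℤ -[1+ n ] = - fromℕ (suc n)

  -- Induction on both arguments: adding 1 to each natural number leaves the difference unchanged.
  fromℤ-⊖ : ∀ m n → fromℤ (m ⊖ n) ≈ fromℕ m - fromℕ n
  fromℤ-⊖ zero    zero    = sym (-‿inverseʳ 0#)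
  fromℤ-⊖ zero    (suc n) = sym (+-identityˡ _)
  fromℤ-⊖ (suc m) zero    = sym (trans (+-congˡ ε⁻¹≈ε) (+-identityʳ _))
  fromℤ-⊖ (suc m) (suc n) = begin
    fromℤ (suc m ⊖ suc n)                    ≡⟨ ≡.cong fromℤ ([1+m]⊖[1+n]≡m⊖n m n) ⟩
    fromℤ (m ⊖ n)                            ≈⟨ fromℤ-⊖ m n ⟩
    fromℕ m - fromℕ n                        ≈⟨ +-identityˡ _ ⟨
    0# + (fromℕ m - fromℕ n)                 ≈⟨ +-congʳ (-‿inverseʳ 1#) ⟨
    (1# - 1#) + (fromℕ m - fromℕ n)          ≈⟨ interchange _ _ _ _ ⟩
    (1# + fromℕ m) + (- 1# - fromℕ n)        ≈⟨ +-congˡ (⁻¹-∙-comm _ _) ⟩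
    (1# + fromℕ m) - (1# + fromℕ n)          ≈⟨ +-cong (×-homo-+ 1# 1 m) (-‿cong (×-homo-+ 1# 1 n)) ⟨
    fromℕ (suc m) - fromℕ (suc n)            ∎

  fromℤ-+ : ∀ i j → fromℤ (i ℤ.+ j) ≈ fromℤ i + fromℤ j
  fromℤ-+ (+ m)    (+ n)    = ×-homo-+ 1# m n
  fromℤ-+ (+ m)    -[1+ n ] = fromℤ-⊖ m (suc n)
  fromℤ-+ -[1+ m ] (+ n)    = trans (fromℤ-⊖ n (suc m)) (+-comm _ _)
  fromℤ-+ -[1+ m ] -[1+ n ] = begin
    - fromℕ (suc (suc (m ℕ.+ n)))      ≡⟨ ≡.cong (λ k → - fromℕ (suc k)) (+-suc m n) ⟨
    - fromℕ (suc m ℕ.+ suc n)          ≈⟨ -‿cong (×-homo-+ 1# (suc m) (suc n)) ⟩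
    - (fromℕ (suc m) + fromℕ (suc n))  ≈⟨ ⁻¹-∙-comm _ _ ⟨
    - fromℕ (suc m) - fromℕ (suc n)    ∎
    where open import Data.Nat.Properties using (+-suc)

  fromℤ-neg : ∀ i → fromℤ (ℤ.- i) ≈ - fromℤ i
  fromℤ-neg (+ zero)  = sym ε⁻¹≈ε
  fromℤ-neg (+ suc n) = refl
  fromℤ-neg -[1+ n ]  = sym (⁻¹-involutive _)

  fromℤ-+◃ : ∀ n → fromℤ (Sign.+ ◃ n) ≈ fromℕ n
  fromℤ-+◃ zero    = refl
  fromℤ-+◃ (suc n) = refl

  fromℤ--◃ : ∀ n → fromℤ (Sign.- ◃ n) ≈ - fromℕ n
  fromℤ--◃ zero    = sym ε⁻¹≈ε
  fromℤ--◃ (suc n) = refl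

  fromℤ-* : ∀ i j → fromℤ (i ℤ.* j) ≈ fromℤ i * fromℤ j
  fromℤ-* (+ m)    (+ n)    = trans (fromℤ-+◃ (m ℕ.* n)) (×1-homo-* m n)
  fromℤ-* (+ m)    -[1+ n ] = trans (fromℤ--◃ (m ℕ.* suc n))
    (trans (-‿cong (×1-homo-* m (suc n))) (-‿distribʳ-* _ _))
  fromℤ-* -[1+ m ] (+ n)    = trans (fromℤ--◃ (suc m ℕ.* n))
    (trans (-‿cong (×1-homo-* (suc m) n)) (-‿distribˡ-* _ _))
  fromℤ-* -[1+ m ] -[1+ n ] = begin
    fromℕ (suc m ℕ.* suc n)              ≈⟨ ×1-homo-* (suc m) (suc n) ⟩
    fromℕ (suc m) * fromℕ (suc n)        ≈⟨ ⁻¹-involutive _ ⟨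
    - - (fromℕ (suc m) * fromℕ (suc n))  ≈⟨ -‿cong (-‿distribʳ-* _ _) ⟩
    - (fromℕ (suc m) * - fromℕ (suc n))  ≈⟨ -‿distribˡ-* _ _ ⟩
    - fromℕ (suc m) * - fromℕ (suc n)    ∎

  morphism : ℤ.+-*-rawRing -Raw-AlmostCommutative⟶ fromCommutativeRing R
  morphism = record
    { ⟦_⟧    = fromℤ
    ; +-homo = fromℤ-+
    ; *-homo = fromℤ-*
    ; -‿homo = fromℤ-neg
    ; 0-homo = refl
    ; 1-homo = refl
    }

  -- Distinct integers can coincide in a ring of positive characteristic, so only positive answers
  -- are given.
  fromℤ-≟ : ∀ i j → Maybe (fromℤ i ≈ fromℤ j)
  fromℤ-≟ i j with i ℤ≟ j
  ... | yes ≡.refl = just refl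
  ... | no  _      = nothing

  open import Algebra.Solver.Ring _ _ morphism fromℤ-≟ public
    using (solve; _:=_; _:+_; _:*_; _:-_; :-_; con; Polynomial)

module _ (em : ExcludedMiddle 0ℓ) (𝓡 : CompleteOrderedField) where

  open Complex em 𝓡
  open IntegerRingSolver commutativeRing

  -- Order, cancellation and division in an ordered field.

  module OrderedField where
    open IsTotalOrder ≤-isTotalOrder public
      using (total; antisym; isPartialOrder)
      renaming (trans to ≤-trans; reflexive to ≤-reflexive; refl to ≤-refl)

    ≤-poset : Poset 0ℓ 0ℓ 0ℓ
    ≤-poset = record { isPartialOrder = isPartialOrder }

    open import Relation.Binary.Reasoning.PartialOrder ≤-poset

    ≤-resp-≈ : ∀ {x x′ y y′} → x ≈ x′ → y ≈ y′ → x ≤ y → x′ ≤ y′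
    ≤-resp-≈ p q x≤y = ≤-trans (≤-reflexive (sym p)) (≤-trans x≤y (≤-reflexive q))

    x≤y⇒0≤y-x : ∀ {x y} → x ≤ y → 0# ≤ y - x
    x≤y⇒0≤y-x {x} x≤y = ≤-resp-≈ (-‿inverseʳ x) refl (+-monoˡ-≤ (- x) x≤y)

    0≤y-x⇒x≤y : ∀ {x y} → 0# ≤ y - x → x ≤ y
    0≤y-x⇒x≤y {x} {y} h = ≤-resp-≈ (+-identityˡ x)
      (solve 2 (λ x y → y :- x :+ x := y) refl x y) (+-monoˡ-≤ x h)

    -- The shape in which the solver serves for inequalities: it rewrites `y - x` into an expression
    -- that is visibly nonnegative.
    difference-nonneg : ∀ {x y d} → y - x ≈ d → 0# ≤ d → x ≤ y
    difference-nonneg e 0≤d = 0≤y-x⇒x≤y (≤-resp-≈ refl (sym e) 0≤d)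

    +-mono-≤ : ∀ {x y u v} → x ≤ y → u ≤ v → x + u ≤ y + v
    +-mono-≤ {x} {y} {u} {v} x≤y u≤v = ≤-trans (+-monoˡ-≤ u x≤y)
      (≤-resp-≈ (+-comm u y) (+-comm v y) (+-monoˡ-≤ y u≤v))

    +-nonneg : ∀ {x y} → 0# ≤ x → 0# ≤ y → 0# ≤ x + y
    +-nonneg 0≤x 0≤y = ≤-resp-≈ (+-identityˡ 0#) refl (+-mono-≤ 0≤x 0≤y)

    *-monoˡ-≤ : ∀ {z x y} → 0# ≤ z → x ≤ y → z * x ≤ z * y
    *-monoˡ-≤ {z} {x} {y} 0≤z x≤y = difference-nonneg
      (solve 3 (λ x y z → z :* y :- z :* x := z :* (y :- x)) refl x y z)
      (*-nonneg 0≤z (x≤y⇒0≤y-x x≤y))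

    square-nonneg : ∀ x → 0# ≤ x * x
    square-nonneg = SquareRoot.x*x-nonneg

    normSq-nonneg : ∀ z → 0# ≤ normSq z
    normSq-nonneg z = SquareRoot.+-squares-nonneg (re z) (im z)

    0≤1 : 0# ≤ 1#
    0≤1 = ≤-resp-≈ refl (*-identityˡ 1#) (square-nonneg 1#)

    0<1 : 0# < 1#
    0<1 = 0≤1 , 0≉1

    <⇒≉ : ∀ {x} → 0# < x → ¬ (x ≈ 0#)
    <⇒≉ (_ , 0≉x) x≈0 = 0≉x (sym x≈0)

    ≤∧≉⇒< : ∀ {x} → 0# ≤ x → ¬ (x ≈ 0#) → 0# < x
    ≤∧≉⇒< 0≤x x≉0 = 0≤x , λ 0≈x → x≉0 (sym 0≈x)

    <-≤-trans : ∀ {x y} → 0# < x → x ≤ y → 0# < y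
    <-≤-trans {x} (0≤x , 0≉x) x≤y =
      ≤-trans 0≤x x≤y , λ 0≈y → 0≉x (antisym 0≤x (≤-resp-≈ refl (sym 0≈y) x≤y))

    *-inverseʳ : ∀ x → ¬ (x ≈ 0#) → x * x ⁻¹ ≈ 1#
    *-inverseʳ x x≉0 with em {x ≈ 0#}
    ... | yes x≈0 = contradiction x≈0 x≉0
    ... | no  x≉0′ = proj₂ (inverse x x≉0′)

    *-cancelˡ-≈0 : ∀ {c x} → ¬ (c ≈ 0#) → c * x ≈ 0# → x ≈ 0#
    *-cancelˡ-≈0 {c} {x} c≉0 cx≈0 = begin-equality
      x                 ≈⟨ *-identityˡ x ⟨
      1# * x            ≈⟨ *-congʳ (*-inverseʳ c c≉0) ⟨
      c * c ⁻¹ * x      ≈⟨ solve 3 (λ c i x → c :* i :* x := i :* (c :* x)) refl c (c ⁻¹) x ⟩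
      c ⁻¹ * (c * x)    ≈⟨ *-congˡ cx≈0 ⟩
      c ⁻¹ * 0#         ≈⟨ zeroʳ _ ⟩
      0#                ∎

    *-cancelˡ-≈ : ∀ {c x y} → ¬ (c ≈ 0#) → c * x ≈ c * y → x ≈ y
    *-cancelˡ-≈ {c} {x} {y} c≉0 cx≈cy = begin-equality
      x            ≈⟨ solve 2 (λ x y → x := x :- y :+ y) refl x y ⟩
      x - y + y    ≈⟨ +-congʳ (*-cancelˡ-≈0 c≉0 c[x-y]≈0) ⟩
      0# + y       ≈⟨ +-identityˡ y ⟩
      y            ∎
      where
      c[x-y]≈0 : c * (x - y) ≈ 0#
      c[x-y]≈0 = trans (solve 3 (λ c x y → c :* (x :- y) := c :* x :- c :* y) refl c x y)
        (trans (+-congʳ cx≈cy) (-‿inverseʳ _))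

    *-≉0 : ∀ {x y} → ¬ (x ≈ 0#) → ¬ (y ≈ 0#) → ¬ (x * y ≈ 0#)
    *-≉0 x≉0 y≉0 xy≈0 = y≉0 (*-cancelˡ-≈0 x≉0 xy≈0)

    *-pos : ∀ {x y} → 0# < x → 0# < y → 0# < x * y
    *-pos 0<x 0<y = ≤∧≉⇒< (*-nonneg (proj₁ 0<x) (proj₁ 0<y)) (*-≉0 (<⇒≉ 0<x) (<⇒≉ 0<y))

    -- If `x ≤ 0#`, then `c * x` is both nonpositive and nonnegative, hence zero, and `x` is zero as
    -- well.
    *-cancelˡ-nonneg : ∀ {c x} → 0# < c → 0# ≤ c * x → 0# ≤ x
    *-cancelˡ-nonneg {c} {x} 0<c 0≤cx with total 0# x
    ... | inj₁ 0≤x = 0≤x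
    ... | inj₂ x≤0 = ≤-reflexive (sym (*-cancelˡ-≈0 (<⇒≉ 0<c) (antisym
      (≤-resp-≈ refl (zeroʳ c) (*-monoˡ-≤ (proj₁ 0<c) x≤0)) 0≤cx)))

    *-cancelˡ-≤ : ∀ {c x y} → 0# < c → c * x ≤ c * y → x ≤ y
    *-cancelˡ-≤ {c} {x} {y} 0<c cx≤cy = 0≤y-x⇒x≤y (*-cancelˡ-nonneg 0<c
      (≤-resp-≈ refl (solve 3 (λ c x y → c :* y :- c :* x := c :* (y :- x)) refl c x y)
        (x≤y⇒0≤y-x cx≤cy)))

    ⁻¹-pos : ∀ {x} → 0# < x → 0# < x ⁻¹
    ⁻¹-pos {x} 0<x = *-cancelˡ-nonneg 0<x (≤-resp-≈ refl (sym x*x⁻¹≈1) 0≤1)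
      , λ 0≈x⁻¹ → 0≉1 (trans (sym (zeroʳ x)) (trans (*-congˡ 0≈x⁻¹) x*x⁻¹≈1))
      where x*x⁻¹≈1 = *-inverseʳ x (<⇒≉ 0<x)

    *-/-cancel : ∀ x {y} → ¬ (y ≈ 0#) → y * (x / y) ≈ x
    *-/-cancel x {y} y≉0 = begin-equality
      y * (x * y ⁻¹)  ≈⟨ solve 3 (λ x y i → y :* (x :* i) := y :* i :* x) refl x y (y ⁻¹) ⟩
      y * y ⁻¹ * x    ≈⟨ *-congʳ (*-inverseʳ y y≉0) ⟩
      1# * x          ≈⟨ *-identityˡ x ⟩
      x               ∎

    /-unique : ∀ {x y z} → ¬ (y ≈ 0#) → y * z ≈ x → z ≈ x / y
    /-unique y≉0 yz≈x = *-cancelˡ-≈ y≉0 (trans yz≈x (sym (*-/-cancel _ y≉0)))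

    +-≈0⇒≈0 : ∀ {x y} → 0# ≤ x → 0# ≤ y → x + y ≈ 0# → x ≈ 0#
    +-≈0⇒≈0 {x} {y} 0≤x 0≤y x+y≈0 = antisym
      (≤-resp-≈ (+-identityʳ x) x+y≈0 (+-mono-≤ ≤-refl 0≤y)) 0≤x

    square≈0⇒≈0 : ∀ {x} → x * x ≈ 0# → x ≈ 0#
    square≈0⇒≈0 {x} xx≈0 with em {x ≈ 0#}
    ... | yes x≈0 = x≈0
    ... | no  x≉0 = *-cancelˡ-≈0 x≉0 xx≈0

    normSq≈0⇒≈0 : ∀ {z} → normSq z ≈ 0# → z ≈ᶜ 0ᶜ
    normSq≈0⇒≈0 {z} h =
        square≈0⇒≈0 (+-≈0⇒≈0 (square-nonneg _) (square-nonneg _) h)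
      , square≈0⇒≈0 (+-≈0⇒≈0 (square-nonneg _) (square-nonneg _) (trans (+-comm _ _) h))

    square-mono-≤ : ∀ {x y} → 0# ≤ x → x ≤ y → x * x ≤ y * y
    square-mono-≤ {x} {y} 0≤x x≤y = difference-nonneg
      (solve 2 (λ x y → y :* y :- x :* x := (y :- x) :* (y :+ x)) refl x y)
      (*-nonneg (x≤y⇒0≤y-x x≤y) (+-nonneg (≤-trans 0≤x x≤y) 0≤x))

    -- If `y ≤ x`, then (x - y)² = x² - y² - 2 y (x - y) ≤ 0, which forces `x ≈ y`.
    square-cancel-≤ : ∀ {x y} → 0# ≤ y → x * x ≤ y * y → x ≤ y
    square-cancel-≤ {x} {y} 0≤y xx≤yy with total x y
    ... | inj₁ x≤y = x≤y
    ... | inj₂ y≤x = ≤-reflexive (trans (solve 2 (λ x y → x := x :- y :+ y) refl x y)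
      (trans (+-congʳ (square≈0⇒≈0 (antisym d²≤0 (square-nonneg _)))) (+-identityˡ y)))
      where
      0≤d : 0# ≤ x - y
      0≤d = x≤y⇒0≤y-x y≤x
      d²≤0 : (x - y) * (x - y) ≤ 0#
      d²≤0 = difference-nonneg
        (solve 2 (λ x y → con (+ 0) :- (x :- y) :* (x :- y)
                       := y :* y :- x :* x :+ con (+ 2) :* (y :* (x :- y))) refl x y)
        (+-nonneg (x≤y⇒0≤y-x xx≤yy) (*-nonneg (+-nonneg 0≤1 0≤1) (*-nonneg 0≤y 0≤d)))

    2≉0 : ¬ (1# + 1# ≈ 0#)
    2≉0 = <⇒≉ (<-≤-trans 0<1 (≤-resp-≈ (+-identityʳ 1#) refl (+-mono-≤ ≤-refl 0≤1)))

    half : ℝ → ℝ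
    half x = x / (1# + 1#)

    half+half : ∀ x → half x + half x ≈ x
    half+half x = trans (solve 1 (λ h → h :+ h := con (+ 2) :* h) refl (half x))
      (*-/-cancel x 2≉0)

    half-pos : ∀ {x} → 0# < x → 0# < half x
    half-pos 0<x = *-pos 0<x (⁻¹-pos (≤∧≉⇒< (+-nonneg 0≤1 0≤1) 2≉0))

    -- Applied with half the gap `x - y` as ε; doubling the resulting inequality leaves
    -- `0# ≤ y - x`.
    infinitesimal-≤ : ∀ {x y} → (∀ ε → 0# < ε → x ≤ y + ε) → x ≤ y
    infinitesimal-≤ {x} {y} h with total x y
    ... | inj₁ x≤y = x≤y
    ... | inj₂ y≤x with em {x - y ≈ 0#}
    ...   | yes x-y≈0 = ≤-reflexive (trans (solve 2 (λ x y → x := x :- y :+ y) refl x y)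
                          (trans (+-congʳ x-y≈0) (+-identityˡ y)))
    ...   | no  x-y≉0 = difference-nonneg (begin-equality
      y - x                                ≈⟨ solve 2 (λ x y → y :- x := con (+ 2) :* (y :- x) :+ (x :- y)) refl x y ⟩
      (1# + 1#) * (y - x) + (x - y)        ≈⟨ +-congˡ (half+half (x - y)) ⟨
      (1# + 1#) * (y - x) + (ε + ε)        ≈⟨ solve 3 (λ x y e → con (+ 2) :* (y :- x) :+ (e :+ e)
                                                := (y :+ e :- x) :+ (y :+ e :- x)) refl x y ε ⟩
      (y + ε - x) + (y + ε - x)            ∎)
      (+-nonneg 0≤y+ε-x 0≤y+ε-x)
      where
      ε = half (x - y)
      0≤y+ε-x : 0# ≤ y + ε - x
      0≤y+ε-x = x≤y⇒0≤y-x (h ε (half-pos (≤∧≉⇒< (x≤y⇒0≤y-x y≤x) x-y≉0)))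

  open OrderedField
  open import Relation.Binary.Reasoning.PartialOrder ≤-poset

  -- Unconditional sums of real families.

  module RealSums {G : Set} where

    partialSumᵣ : (G → ℝ) → List G → ℝ
    partialSumᵣ f = foldr (λ π s → f π + s) 0#

    -- Two weak one-sided bounds take the place of a modulus; as ε ranges over all positive reals,
    -- they define the same limits as strict bounds.
    EventuallyWithin : ℝ → (G → ℝ) → ℝ → Set
    EventuallyWithin ε f s = ∃[ F ] (∀ F′ → Unique F′ → F ⊆ F′ →
      s ≤ partialSumᵣ f F′ + ε × partialSumᵣ f F′ ≤ s + ε)

    HasSumᵣ : (G → ℝ) → ℝ → Set
    HasSumᵣ f s = ∀ ε → 0# < ε → EventuallyWithin ε f s

    partialSumᵣ-cong : ∀ {f g} → (∀ π → f π ≈ g π) → ∀ F → partialSumᵣ f F ≈ partialSumᵣ g F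
    partialSumᵣ-cong f≈g []      = refl
    partialSumᵣ-cong f≈g (π ∷ F) = +-cong (f≈g π) (partialSumᵣ-cong f≈g F)

    partialSumᵣ-+ : ∀ f g F → partialSumᵣ (λ π → f π + g π) F ≈ partialSumᵣ f F + partialSumᵣ g F
    partialSumᵣ-+ f g []      = sym (+-identityˡ 0#)
    partialSumᵣ-+ f g (π ∷ F) = trans (+-congˡ (partialSumᵣ-+ f g F))
      (solve 4 (λ a b s t → a :+ b :+ (s :+ t) := a :+ s :+ (b :+ t)) refl
        (f π) (g π) (partialSumᵣ f F) (partialSumᵣ g F))

    partialSumᵣ-* : ∀ c f F → partialSumᵣ (λ π → c * f π) F ≈ c * partialSumᵣ f F
    partialSumᵣ-* c f []      = sym (zeroʳ c)
    partialSumᵣ-* c f (π ∷ F) = trans (+-congˡ (partialSumᵣ-* c f F)) (sym (distribˡ c (f π) (partialSumᵣ f F)))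

    partialSumᵣ-mono : ∀ {f g} → (∀ π → f π ≤ g π) → ∀ F → partialSumᵣ f F ≤ partialSumᵣ g F
    partialSumᵣ-mono f≤g []      = ≤-refl
    partialSumᵣ-mono f≤g (π ∷ F) = +-mono-≤ (f≤g π) (partialSumᵣ-mono f≤g F)

    partialSumᵣ-nonneg : ∀ {f} → (∀ π → 0# ≤ f π) → ∀ F → 0# ≤ partialSumᵣ f F
    partialSumᵣ-nonneg 0≤f []      = ≤-refl
    partialSumᵣ-nonneg 0≤f (π ∷ F) = +-nonneg (0≤f π) (partialSumᵣ-nonneg 0≤f F)

    partialSumᵣ-insert : ∀ f H π K →
      partialSumᵣ f (H ++ π ∷ K) ≈ f π + partialSumᵣ f (H ++ K)
    partialSumᵣ-insert f []      π K = refl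
    partialSumᵣ-insert f (ρ ∷ H) π K = trans (+-congˡ (partialSumᵣ-insert f H π K))
      (solve 3 (λ a b s → a :+ (b :+ s) := b :+ (a :+ s)) refl (f ρ) (f π) (partialSumᵣ f (H ++ K)))

    -- Induction on `F`: its head is located in `F′` and removed there, and uniqueness keeps the
    -- tail of `F` inside what remains.
    partialSumᵣ-⊆ : ∀ {f} → (∀ π → 0# ≤ f π) → ∀ {F F′} → Unique F → F ⊆ F′ →
                    partialSumᵣ f F ≤ partialSumᵣ f F′
    partialSumᵣ-⊆ 0≤f {[]}    {F′} _ _ = partialSumᵣ-nonneg 0≤f F′
    partialSumᵣ-⊆ {f} 0≤f {π ∷ F} {F′} (π∉F ∷ F!) πF⊆F′ with ∈-∃++ (πF⊆F′ (here ≡.refl))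
    ... | H , K , ≡.refl = begin
      f π + partialSumᵣ f F         ≤⟨ +-mono-≤ ≤-refl (partialSumᵣ-⊆ 0≤f F! F⊆HK) ⟩
      f π + partialSumᵣ f (H ++ K)  ≈⟨ partialSumᵣ-insert f H π K ⟨
      partialSumᵣ f (H ++ π ∷ K)    ∎
      where
      F⊆HK : F ⊆ H ++ K
      F⊆HK {ρ} ρ∈F with ∈-++⁻ H (πF⊆F′ (there ρ∈F))
      ... | inj₁ ρ∈H           = ∈-++⁺ˡ ρ∈H
      ... | inj₂ (there ρ∈K)   = ∈-++⁺ʳ H ρ∈K
      ... | inj₂ (here ≡.refl) = contradiction ≡.refl (All.lookup π∉F ρ∈F)

    -- Limits range over duplicate-free lists only, whereas unions are formed by `++`. Excluded
    -- middle decides equality on `G`, so duplicates can be removed.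
    unique-superset : ∀ F → ∃[ F′ ] Unique F′ × F ⊆ F′
    unique-superset F = deduplicate _≟_ F , deduplicate-! _≟_ F , ∈-deduplicate⁺ _≟_
      where
      _≟_ = λ (π ρ : G) → em {π ≡ ρ}

    HasSumᵣ-cong : ∀ {f g s t} → (∀ π → f π ≈ g π) → s ≈ t → HasSumᵣ f s → HasSumᵣ g t
    HasSumᵣ-cong f≈g s≈t hs ε 0<ε with hs ε 0<ε
    ... | F , bounds = F , λ F′ F′! F⊆F′ →
        ≤-resp-≈ s≈t (+-congʳ (partialSumᵣ-cong f≈g F′)) (proj₁ (bounds F′ F′! F⊆F′))
      , ≤-resp-≈ (partialSumᵣ-cong f≈g F′) (+-congʳ s≈t) (proj₂ (bounds F′ F′! F⊆F′))

    HasSumᵣ-+ : ∀ {f g s t} → HasSumᵣ f s → HasSumᵣ g t → HasSumᵣ (λ π → f π + g π) (s + t)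
    HasSumᵣ-+ {f} {g} {s} {t} hs ht ε 0<ε =
      let (F , boundsˢ) = hs (half ε) (half-pos 0<ε)
          (H , boundsᵗ) = ht (half ε) (half-pos 0<ε)
      in F ++ H , λ F′ F′! FH⊆F′ →
      let (l , u)   = boundsˢ F′ F′! (λ p → FH⊆F′ (∈-++⁺ˡ p))
          (l′ , u′) = boundsᵗ F′ F′! (λ p → FH⊆F′ (∈-++⁺ʳ F p))
          Σ≈        = partialSumᵣ-+ f g F′
      in ≤-resp-≈ refl (trans (regroup _ _) (+-congʳ (sym Σ≈))) (+-mono-≤ l l′)
       , ≤-resp-≈ (sym Σ≈) (regroup _ _) (+-mono-≤ u u′)
      where
      regroup : ∀ x y → (x + half ε) + (y + half ε) ≈ (x + y) + ε
      regroup x y = trans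
        (solve 3 (λ x y h → (x :+ h) :+ (y :+ h) := x :+ y :+ (h :+ h)) refl x y (half ε))
        (+-congˡ (half+half ε))

    private
      HasSumᵣ-*-nonneg : ∀ {f s} c → 0# ≤ c → HasSumᵣ f s → HasSumᵣ (λ π → c * f π) (c * s)
      HasSumᵣ-*-nonneg {f} {s} c 0≤c hs ε 0<ε = proj₁ near , λ F′ F′! F⊆F′ →
        let (l , u) = proj₂ near F′ F′! F⊆F′
            Σ≈      = partialSumᵣ-* c f F′
        in ≤-resp-≈ refl (+-congʳ (sym Σ≈)) (scale l) , ≤-resp-≈ (sym Σ≈) refl (scale u)
        where
        0<1+c : 0# < 1# + c
        0<1+c = <-≤-trans 0<1 (≤-resp-≈ (+-identityʳ 1#) refl (+-mono-≤ ≤-refl 0≤c))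
        -- Dividing by 1 + c rather than by c also covers c = 0.
        η : ℝ
        η = ε / (1# + c)
        0<η : 0# < η
        0<η = *-pos 0<ε (⁻¹-pos 0<1+c)
        near : EventuallyWithin η f s
        near = hs η 0<η
        cη≤ε : c * η ≤ ε
        cη≤ε = difference-nonneg
          (trans (+-congʳ (sym (*-/-cancel ε (<⇒≉ 0<1+c))))
            (solve 2 (λ c η → (con (+ 1) :+ c) :* η :- c :* η := η) refl c η))
          (proj₁ 0<η)
        scale : ∀ {x y} → x ≤ y + η → c * x ≤ c * y + ε
        scale {x} {y} h = begin
          c * x          ≤⟨ *-monoˡ-≤ 0≤c h ⟩
          c * (y + η)    ≈⟨ distribˡ c y η ⟩
          c * y + c * η  ≤⟨ +-mono-≤ ≤-refl cη≤ε ⟩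
          c * y + ε      ∎

    HasSumᵣ-neg : ∀ {f s} → HasSumᵣ f s → HasSumᵣ (λ π → - f π) (- s)
    HasSumᵣ-neg {f} {s} hs ε 0<ε with hs ε 0<ε
    ... | F , bounds = F , λ F′ F′! F⊆F′ →
      let (l , u) = bounds F′ F′! F⊆F′
      in ≤-resp-≈ refl (+-congʳ (Σ-neg F′)) (flip u) , ≤-resp-≈ (Σ-neg F′) refl (flip l)
      where
      flip : ∀ {x y} → x ≤ y + ε → - y ≤ - x + ε
      flip {x} {y} h = difference-nonneg
        (solve 3 (λ x y e → :- x :+ e :- :- y := y :+ e :- x) refl x y ε) (x≤y⇒0≤y-x h)
      Σ-neg : ∀ F → - partialSumᵣ f F ≈ partialSumᵣ (λ π → - f π) F
      Σ-neg []      = solve 0 (:- con (+ 0) := con (+ 0)) refl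
      Σ-neg (π ∷ F) = trans (solve 2 (λ x y → :- (x :+ y) := :- x :+ :- y) refl (f π) (partialSumᵣ f F))
        (+-congˡ (Σ-neg F))

    HasSumᵣ-* : ∀ {f s} c → HasSumᵣ f s → HasSumᵣ (λ π → c * f π) (c * s)
    HasSumᵣ-* {f} {s} c hs with total 0# c
    ... | inj₁ 0≤c = HasSumᵣ-*-nonneg c 0≤c hs
    ... | inj₂ c≤0 = HasSumᵣ-cong (λ π → e c (f π)) (e c s)
      (HasSumᵣ-*-nonneg (- c) (≤-resp-≈ refl (+-identityˡ (- c)) (x≤y⇒0≤y-x c≤0)) (HasSumᵣ-neg hs))
      where
      e : ∀ c x → - c * - x ≈ c * x
      e = solve 2 (λ c x → :- c :* :- x := c :* x) refl

    HasSumᵣ-0 : HasSumᵣ (λ _ → 0#) 0#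
    HasSumᵣ-0 ε (0≤ε , _) = [] , λ F′ _ _ →
        ≤-resp-≈ (+-identityˡ 0#) refl (+-mono-≤ (≤-reflexive (sym (Σ0≈0 F′))) 0≤ε)
      , ≤-resp-≈ (+-identityʳ _) refl (+-mono-≤ (≤-reflexive (Σ0≈0 F′)) 0≤ε)
      where
      Σ0≈0 : ∀ F → partialSumᵣ (λ _ → 0#) F ≈ 0#
      Σ0≈0 []      = refl
      Σ0≈0 (π ∷ F) = trans (+-identityˡ _) (Σ0≈0 F)

    -- Enlarging `F` until its partial sum is within ε of the limit can only increase that partial
    -- sum, because the terms are nonnegative.
    partialSumᵣ≤sum : ∀ {f s} → (∀ π → 0# ≤ f π) → HasSumᵣ f s →
                      ∀ F → Unique F → partialSumᵣ f F ≤ s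
    partialSumᵣ≤sum {f} {s} 0≤f hs F F! = infinitesimal-≤ λ ε 0<ε →
      let (H , bounds)          = hs ε 0<ε
          (F′ , F′! , FH⊆F′)    = unique-superset (F ++ H)
      in ≤-trans (partialSumᵣ-⊆ 0≤f F! (λ p → FH⊆F′ (∈-++⁺ˡ p)))
           (proj₂ (bounds F′ F′! (λ p → FH⊆F′ (∈-++⁺ʳ F p))))

    HasSumᵣ-nonneg : ∀ {f s} → (∀ π → 0# ≤ f π) → HasSumᵣ f s → 0# ≤ s
    HasSumᵣ-nonneg 0≤f hs = partialSumᵣ≤sum 0≤f hs [] []

    term≤sum : ∀ {f s} → (∀ π → 0# ≤ f π) → HasSumᵣ f s → ∀ π → f π ≤ s
    term≤sum 0≤f hs π = ≤-resp-≈ (+-identityʳ _) refl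
      (partialSumᵣ≤sum 0≤f hs (π ∷ []) (All.[] ∷ []))

    -- The zero family `f - f` sums to the difference of the two limits, which is therefore
    -- nonnegative; exchanging the limits gives equality.
    HasSumᵣ-unique : ∀ {f s t} → HasSumᵣ f s → HasSumᵣ f t → s ≈ t
    HasSumᵣ-unique {f} hs ht = antisym (le hs ht) (le ht hs)
      where
      le : ∀ {s t} → HasSumᵣ f s → HasSumᵣ f t → s ≤ t
      le {s} {t} hs ht = 0≤y-x⇒x≤y (HasSumᵣ-nonneg (λ _ → ≤-refl)
        (HasSumᵣ-cong (λ π → -‿inverseʳ (f π)) refl (HasSumᵣ-+ ht (HasSumᵣ-neg hs))))

    -- Partial sums of nonnegative terms increase along inclusion, so their supremum over the finite
    -- subsets is the limit.
    bounded⇒HasSumᵣ : ∀ {f b} → (∀ π → 0# ≤ f π) →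
      (∀ F → Unique F → partialSumᵣ f F ≤ b) → ∃ (HasSumᵣ f)
    bounded⇒HasSumᵣ {f} {b} 0≤f bound
      with complete (λ x → ∃[ F ] Unique F × partialSumᵣ f F ≈ x)
        (0# , [] , [] , refl) (b , λ { x (F , F! , Σ≈x) → ≤-resp-≈ Σ≈x refl (bound F F!) })
    ... | s , upper , least = s , hs
      where
      hs : HasSumᵣ f s
      hs ε (0≤ε , 0≉ε) with em {∃[ F ] Unique F × s ≤ partialSumᵣ f F + ε}
      ... | yes (F , F! , s≤Σ+ε) = F , λ F′ F′! F⊆F′ →
          ≤-trans s≤Σ+ε (+-monoˡ-≤ ε (partialSumᵣ-⊆ 0≤f F! F⊆F′))
        , ≤-resp-≈ (+-identityʳ _) refl (+-mono-≤ (upper _ (F′ , F′! , refl)) 0≤ε)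
      ... | no none = contradiction (antisym 0≤ε ε≤0) 0≉ε
        where
        -- If no finite subset came within ε of the supremum, then `s - ε` would be a smaller upper
        -- bound.
        s-ε-upper : IsUpperBound (λ x → ∃[ F ] Unique F × partialSumᵣ f F ≈ x) (s - ε)
        s-ε-upper x (F , F! , Σ≈x) with total x (s - ε)
        ... | inj₁ x≤s-ε = x≤s-ε
        ... | inj₂ s-ε≤x = contradiction (F , F! , ≤-resp-≈
          (solve 2 (λ s e → s :- e :+ e := s) refl s ε) (+-congʳ (sym Σ≈x)) (+-monoˡ-≤ ε s-ε≤x)) none
        ε≤0 : ε ≤ 0#
        ε≤0 = difference-nonneg (solve 2 (λ s e → con (+ 0) :- e := s :- e :- s) refl s ε)
          (x≤y⇒0≤y-x (least (s - ε) s-ε-upper))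

    -- f = (g + f) − g, where g + f is nonnegative with partial sums bounded by those of 2 g.
    comparison : ∀ {f g t} → (∀ π → 0# ≤ g π + f π) → (∀ π → 0# ≤ g π - f π) →
                 HasSumᵣ g t → ∃ (HasSumᵣ f)
    comparison {f} {g} {t} 0≤g+f 0≤g-f ht = s - t , HasSumᵣ-cong
      (λ π → solve 2 (λ g f → g :+ f :- g := f) refl (g π) (f π)) refl
      (HasSumᵣ-+ hs (HasSumᵣ-neg ht))
      where
      0≤2g : ∀ π → 0# ≤ g π + g π
      0≤2g π = ≤-resp-≈ refl
        (solve 2 (λ g f → g :+ f :+ (g :- f) := g :+ g) refl (g π) (f π))
        (+-nonneg (0≤g+f π) (0≤g-f π))

      g+f≤2g : ∀ π → g π + f π ≤ g π + g π
      g+f≤2g π = difference-nonneg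
        (solve 2 (λ g f → g :+ g :- (g :+ f) := g :- f) refl (g π) (f π)) (0≤g-f π)

      bound : ∀ F → Unique F → partialSumᵣ (λ π → g π + f π) F ≤ t + t
      bound F F! = ≤-trans (partialSumᵣ-mono g+f≤2g F)
        (partialSumᵣ≤sum 0≤2g (HasSumᵣ-+ {g} {g} ht ht) F F!)

      sum : ∃ (HasSumᵣ (λ π → g π + f π))
      sum = bounded⇒HasSumᵣ 0≤g+f bound

      s = proj₁ sum
      hs = proj₂ sum

  open RealSums

  -- Moduli, and complex sums through their real and imaginary parts.

  module ComplexNumbers where

    ≈ᶜ-trans : ∀ {z u v} → z ≈ᶜ u → u ≈ᶜ v → z ≈ᶜ v
    ≈ᶜ-trans (p , q) (p′ , q′) = trans p p′ , trans q q′

    normSq-cong : ∀ {z u} → z ≈ᶜ u → normSq z ≈ normSq u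
    normSq-cong (p , q) = +-cong (*-cong p p) (*-cong q q)

    ∣∣-nonneg : ∀ z → 0# ≤ ∣ z ∣
    ∣∣-nonneg z = proj₁ (proj₂ (SquareRoot.sqrt (normSq z) (normSq-nonneg z)))

    ∣∣*∣∣ : ∀ z → ∣ z ∣ * ∣ z ∣ ≈ normSq z
    ∣∣*∣∣ z = proj₂ (proj₂ (SquareRoot.sqrt (normSq z) (normSq-nonneg z)))

    x^2≈x*x : ∀ x → x ^ 2 ≈ x * x
    x^2≈x*x x = *-congˡ (*-identityʳ x)

    ∣∣^2 : ∀ z → ∣ z ∣ ^ 2 ≈ normSq z
    ∣∣^2 z = trans (x^2≈x*x ∣ z ∣) (∣∣*∣∣ z)

    square≤normSq : ∀ x y → x * x ≤ x * x + y * y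
    square≤normSq x y = difference-nonneg
      (solve 2 (λ x y → x :* x :+ y :* y :- x :* x := y :* y) refl x y) (square-nonneg y)

    re≤∣∣ : ∀ z → re z ≤ ∣ z ∣
    re≤∣∣ z = square-cancel-≤ (∣∣-nonneg z)
      (≤-resp-≈ refl (sym (∣∣*∣∣ z)) (square≤normSq (re z) (im z)))

    im≤∣∣ : ∀ z → im z ≤ ∣ z ∣
    im≤∣∣ z = square-cancel-≤ (∣∣-nonneg z)
      (≤-resp-≈ refl (trans (+-comm _ _) (sym (∣∣*∣∣ z))) (square≤normSq (im z) (re z)))

    -re≤∣∣ : ∀ z → - re z ≤ ∣ z ∣
    -re≤∣∣ z = square-cancel-≤ (∣∣-nonneg z)
      (≤-resp-≈ (neg² (re z)) (sym (∣∣*∣∣ z)) (square≤normSq (re z) (im z)))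
      where neg² = solve 1 (λ x → x :* x := :- x :* :- x) refl

    -im≤∣∣ : ∀ z → - im z ≤ ∣ z ∣
    -im≤∣∣ z = square-cancel-≤ (∣∣-nonneg z)
      (≤-resp-≈ (neg² (im z)) (trans (+-comm _ _) (sym (∣∣*∣∣ z))) (square≤normSq (im z) (re z)))
      where neg² = solve 1 (λ x → x :* x := :- x :* :- x) refl

    square-≤-of-bounds : ∀ {x h} → 0# ≤ h - x → 0# ≤ h + x → x * x ≤ h * h
    square-≤-of-bounds {x} {h} p q = difference-nonneg
      (solve 2 (λ x h → h :* h :- x :* x := (h :- x) :* (h :+ x)) refl x h) (*-nonneg p q)

    -- The sharp factor √2 is replaced by 2, which keeps further square roots out of the estimate.
    ∣∣≤sum-of-bounds : ∀ {z h} → 0# ≤ h → re z * re z ≤ h * h → im z * im z ≤ h * h → ∣ z ∣ ≤ h + h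
    ∣∣≤sum-of-bounds {z} {h} 0≤h p q = square-cancel-≤ (+-nonneg 0≤h 0≤h) (begin
      ∣ z ∣ * ∣ z ∣      ≈⟨ ∣∣*∣∣ z ⟩
      normSq z           ≤⟨ +-mono-≤ p q ⟩
      h * h + h * h      ≤⟨ difference-nonneg
                              (solve 1 (λ h → (h :+ h) :* (h :+ h) :- (h :* h :+ h :* h)
                                 := h :* h :+ h :* h) refl h)
                              (+-nonneg (square-nonneg h) (square-nonneg h)) ⟩
      (h + h) * (h + h)  ∎)

    module _ {G : Set} where

      re-partialSum : ∀ (f : G → ℂ) F → re (partialSum f F) ≡ partialSumᵣ (re ∘ f) F
      re-partialSum f []      = ≡.refl
      re-partialSum f (π ∷ F) = ≡.cong (_+_ (re (f π))) (re-partialSum f F)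

      im-partialSum : ∀ (f : G → ℂ) F → im (partialSum f F) ≡ partialSumᵣ (im ∘ f) F
      im-partialSum f []      = ≡.refl
      im-partialSum f (π ∷ F) = ≡.cong (_+_ (im (f π))) (im-partialSum f F)

      private
        lower : ∀ {p s ε e} → - (p - s) ≤ e → e ≤ ε → s ≤ p + ε
        lower {p} {s} {ε} h e≤ε = difference-nonneg
          (solve 3 (λ p s ε → p :+ ε :- s := ε :- :- (p :- s)) refl p s ε)
          (x≤y⇒0≤y-x (≤-trans h e≤ε))

        upper : ∀ {p s ε e} → p - s ≤ e → e ≤ ε → p ≤ s + ε
        upper {p} {s} {ε} h e≤ε = difference-nonneg
          (solve 3 (λ p s ε → s :+ ε :- p := ε :- (p :- s)) refl p s ε)
          (x≤y⇒0≤y-x (≤-trans h e≤ε))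

      HasSum⇒re : ∀ {f : G → ℂ} {s} → HasSum f s → HasSumᵣ (re ∘ f) (re s)
      HasSum⇒re {f} {s} hs ε 0<ε with hs ε 0<ε
      ... | F , close = F , bounds
        where
        bounds : ∀ F′ → Unique F′ → F ⊆ F′ →
          re s ≤ partialSumᵣ (re ∘ f) F′ + ε × partialSumᵣ (re ∘ f) F′ ≤ re s + ε
        bounds F′ F′! F⊆F′ rewrite ≡.sym (re-partialSum f F′) =
            lower (-re≤∣∣ (partialSum f F′ -ᶜ s)) (proj₁ (close F′ F′! F⊆F′))
          , upper (re≤∣∣ (partialSum f F′ -ᶜ s)) (proj₁ (close F′ F′! F⊆F′))

      HasSum⇒im : ∀ {f : G → ℂ} {s} → HasSum f s → HasSumᵣ (im ∘ f) (im s)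
      HasSum⇒im {f} {s} hs ε 0<ε with hs ε 0<ε
      ... | F , close = F , bounds
        where
        bounds : ∀ F′ → Unique F′ → F ⊆ F′ →
          im s ≤ partialSumᵣ (im ∘ f) F′ + ε × partialSumᵣ (im ∘ f) F′ ≤ im s + ε
        bounds F′ F′! F⊆F′ rewrite ≡.sym (im-partialSum f F′) =
            lower (-im≤∣∣ (partialSum f F′ -ᶜ s)) (proj₁ (close F′ F′! F⊆F′))
          , upper (im≤∣∣ (partialSum f F′ -ᶜ s)) (proj₁ (close F′ F′! F⊆F′))

      re∧im⇒HasSum : ∀ {f : G → ℂ} {s} →
        HasSumᵣ (re ∘ f) (re s) → HasSumᵣ (im ∘ f) (im s) → HasSum f s
      re∧im⇒HasSum {f} {s} hr hi ε 0<ε =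
        proj₁ nearʳ ++ proj₁ nearⁱ , close
        where
        -- Coordinates within ε / 4 put the modulus within ε / 2, which leaves room for the strict
        -- inequality that `HasSum` demands.
        h : ℝ
        h = half (half ε)
        0<h : 0# < h
        0<h = half-pos (half-pos 0<ε)
        nearʳ : EventuallyWithin h (re ∘ f) (re s)
        nearʳ = hr h 0<h
        nearⁱ : EventuallyWithin h (im ∘ f) (im s)
        nearⁱ = hi h 0<h
        square-bound : ∀ {p p′ s} → p ≡ p′ → s ≤ p′ + h → p′ ≤ s + h → (p - s) * (p - s) ≤ h * h
        square-bound {p} {_} {s} ≡.refl l u = square-≤-of-bounds
          (≤-resp-≈ refl (solve 3 (λ p s h → s :+ h :- p := h :- (p :- s)) refl p s h) (x≤y⇒0≤y-x u))
          (≤-resp-≈ refl (solve 3 (λ p s h → p :+ h :- s := h :+ (p :- s)) refl p s h) (x≤y⇒0≤y-x l))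
        ≤half⇒< : ∀ {x} → x ≤ half ε → x < ε
        ≤half⇒< {x} x≤ = ≤-trans x≤ half≤ε , λ x≈ε → proj₂ (half-pos 0<ε) (antisym (proj₁ (half-pos 0<ε))
          (difference-nonneg
            (trans (solve 2 (λ h e → con (+ 0) :- h := h :- (h :+ h)) refl (half ε) ε)
              (+-congˡ (-‿cong (half+half ε))))
            (x≤y⇒0≤y-x (≤-resp-≈ x≈ε refl x≤))))
          where
          half≤ε : half ε ≤ ε
          half≤ε = ≤-resp-≈ (+-identityʳ _) (half+half ε) (+-mono-≤ ≤-refl (proj₁ (half-pos 0<ε)))
        close : ∀ F′ → Unique F′ → proj₁ nearʳ ++ proj₁ nearⁱ ⊆ F′ → ∣ partialSum f F′ -ᶜ s ∣ < ε
        close F′ F′! FH⊆F′ = ≤half⇒< (≤-resp-≈ refl (half+half (half ε))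
          (∣∣≤sum-of-bounds {partialSum f F′ -ᶜ s} {h} (proj₁ 0<h)
            (square-bound (re-partialSum f F′) (proj₁ boundsʳ) (proj₂ boundsʳ))
            (square-bound (im-partialSum f F′) (proj₁ boundsⁱ) (proj₂ boundsⁱ))))
          where
          boundsʳ : re s ≤ partialSumᵣ (re ∘ f) F′ + h × partialSumᵣ (re ∘ f) F′ ≤ re s + h
          boundsʳ = proj₂ nearʳ F′ F′! (λ p → FH⊆F′ (∈-++⁺ˡ p))
          boundsⁱ : im s ≤ partialSumᵣ (im ∘ f) F′ + h × partialSumᵣ (im ∘ f) F′ ≤ im s + h
          boundsⁱ = proj₂ nearⁱ F′ F′! (λ p → FH⊆F′ (∈-++⁺ʳ (proj₁ nearʳ) p))

      -- Excluded middle supplies `∑ f` with some limit; uniqueness of limits, one coordinate at a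
      -- time, identifies it.
      ∑-HasSum : ∀ {f : G → ℂ} {s} → HasSum f s → ∑ f ≈ᶜ s
      ∑-HasSum {f} {s} hs with em {Summable f}
      ... | yes (t , ht) = HasSumᵣ-unique (HasSum⇒re ht) (HasSum⇒re hs)
                         , HasSumᵣ-unique (HasSum⇒im ht) (HasSum⇒im hs)
      ... | no  none     = contradiction (s , hs) none

  open ComplexNumbers

  -- Symbolic complex arithmetic for the ring solver.

  module ComplexPolynomials where

    -- Operations on ℂPolynomial mirror those on ℂ, so that solver expressions
    -- evaluate definitionally to real and imaginary parts of complex ones.
    record ℂPolynomial (n : ℕ) : Set where
      constructor _:+i_
      field
        :re :im : Polynomial n
    open ℂPolynomial public

    module _ {n : ℕ} where

      infixl 6 _:+ᶜ_ _:-ᶜ_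
      infixl 7 _:*ᶜ_
      _:+ᶜ_ _:-ᶜ_ _:*ᶜ_ : ℂPolynomial n → ℂPolynomial n → ℂPolynomial n
      z :+ᶜ u = (:re z :+ :re u) :+i (:im z :+ :im u)
      z :-ᶜ u = (:re z :- :re u) :+i (:im z :- :im u)
      z :*ᶜ u = (:re z :* :re u :- :im z :* :im u) :+i (:re z :* :im u :+ :im z :* :re u)

      :ofReal : Polynomial n → ℂPolynomial n
      :ofReal x = x :+i con (+ 0)

      :conj : ℂPolynomial n → ℂPolynomial n
      :conj z = :re z :+i (:- :im z)

      :normSq : ℂPolynomial n → Polynomial n
      :normSq z = :re z :* :re z :+ :im z :* :im z

  open ComplexPolynomials

  -- The inverse of |u|² enters the solver as a variable i; each coordinate reduces to |u|² i times
  -- that of z, since u ū = |u|².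
  *-/ᶜ-cancel : ∀ z {u} → ¬ (normSq u ≈ 0#) → u *ᶜ (z /ᶜ u) ≈ᶜ z
  *-/ᶜ-cancel z {u} ∣u∣²≉0 =
      cancel (re z) (solve 5 (λ a b c d i → let u = a :+i b ; z = c :+i d in
        :re (u :*ᶜ (z :*ᶜ (:conj u :*ᶜ :ofReal i))) := :normSq u :* i :* c) refl
        (re u) (im u) (re z) (im z) (normSq u ⁻¹))
    , cancel (im z) (solve 5 (λ a b c d i → let u = a :+i b ; z = c :+i d in
        :im (u :*ᶜ (z :*ᶜ (:conj u :*ᶜ :ofReal i))) := :normSq u :* i :* d) refl
        (re u) (im u) (re z) (im z) (normSq u ⁻¹))
    where
    cancel : ∀ {x} y → x ≈ normSq u * normSq u ⁻¹ * y → x ≈ y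
    cancel y x≈ = trans x≈ (trans (*-congʳ (*-inverseʳ _ ∣u∣²≉0)) (*-identityˡ y))

  -- Means with respect to a summable weight of positive total.

  module Means {G : Set} (w : G → ℝ) (w-nonneg : ∀ π → 0# ≤ w π)
               {W : ℝ} (w-sum : HasSumᵣ w W) (0<W : 0# < W) where

    -- A record rather than a function, so that f and m can be inferred from Mean f m.
    record Mean (f : G → ℝ) (m : ℝ) : Set where
      constructor mkMean
      field
        weightedSum : HasSumᵣ (λ π → w π * f π) (W * m)
    open Mean

    Mean-cong : ∀ {f g m n} → (∀ π → f π ≈ g π) → m ≈ n → Mean f m → Mean g n
    Mean-cong f≈g m≈n (mkMean p) = mkMean (HasSumᵣ-cong (λ π → *-congˡ (f≈g π)) (*-congˡ m≈n) p)

    Mean-unique : ∀ {f m n} → Mean f m → Mean f n → m ≈ n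
    Mean-unique (mkMean p) (mkMean q) = *-cancelˡ-≈ (<⇒≉ 0<W) (HasSumᵣ-unique p q)

    Mean-+ : ∀ {f g m n} → Mean f m → Mean g n → Mean (λ π → f π + g π) (m + n)
    Mean-+ {f} {g} {m} {n} (mkMean p) (mkMean q) = mkMean
      (HasSumᵣ-cong (λ π → sym (distribˡ (w π) (f π) (g π))) (sym (distribˡ W m n)) (HasSumᵣ-+ p q))

    Mean-* : ∀ {f m} c → Mean f m → Mean (λ π → c * f π) (c * m)
    Mean-* {f} {m} c (mkMean p) = mkMean (HasSumᵣ-cong (λ π → swap (w π) (f π)) (swap W m) (HasSumᵣ-* c p))
      where
      swap : ∀ x y → c * (x * y) ≈ x * (c * y)
      swap = solve 3 (λ c x y → c :* (x :* y) := x :* (c :* y)) refl c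

    Mean-const : ∀ c → Mean (λ _ → c) c
    Mean-const c = mkMean (HasSumᵣ-cong (λ π → *-comm c (w π)) (*-comm c W) (HasSumᵣ-* c w-sum))

    Mean-nonneg : ∀ {f m} → (∀ π → 0# ≤ f π) → Mean f m → 0# ≤ m
    Mean-nonneg 0≤f (mkMean p) = *-cancelˡ-nonneg 0<W
      (HasSumᵣ-nonneg (λ π → *-nonneg (w-nonneg π) (0≤f π)) p)

    sum⇒Mean : ∀ {f} → ∃ (HasSumᵣ (λ π → w π * f π)) → ∃ (Mean f)
    sum⇒Mean (s , hs) = s / W , mkMean (HasSumᵣ-cong (λ _ → refl) (sym (*-/-cancel s (<⇒≉ 0<W))) hs)

    Mean-dominated : ∀ {f g m} → (∀ π → 0# ≤ g π + f π) → (∀ π → 0# ≤ g π - f π) →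
                     Mean g m → ∃ (Mean f)
    Mean-dominated {f} {g} 0≤g+f 0≤g-f p = sum⇒Mean {f} (comparison
      {f = λ π → w π * f π} {g = λ π → w π * g π}
      (λ π → ≤-resp-≈ refl (distribˡ (w π) (g π) (f π)) (*-nonneg (w-nonneg π) (0≤g+f π)))
      (λ π → ≤-resp-≈ refl
        (solve 3 (λ w g f → w :* (g :- f) := w :* g :- w :* f) refl (w π) (g π) (f π))
        (*-nonneg (w-nonneg π) (0≤g-f π)))
      (weightedSum p))

    -- For vectors x = (p, q) and y = (r, s), the identity 2 (|x|² + |y|² ± x·y) = |x|² + |y|² + |x
    -- ± y|² shows that x·y is dominated by |x|² + |y|².
    Mean-dot : ∀ {p q r s : G → ℝ} {m n} →
      Mean (λ π → p π * p π + q π * q π) m → Mean (λ π → r π * r π + s π * s π) n →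
      ∃ (Mean (λ π → p π * r π + q π * s π))
    Mean-dot {p} {q} {r} {s} mean-pq mean-rs = Mean-dominated
      {f = λ π → p π * r π + q π * s π}
      {g = λ π → (p π * p π + q π * q π) + (r π * r π + s π * s π)}
      (λ π → plus (p π) (q π) (r π) (s π)) (λ π → minus (p π) (q π) (r π) (s π))
      (Mean-+ {λ π → p π * p π + q π * q π} {λ π → r π * r π + s π * s π} mean-pq mean-rs)
      where
      halve : ∀ {x} → 0# ≤ (1# + 1#) * x → 0# ≤ x
      halve = *-cancelˡ-nonneg (≤∧≉⇒< (+-nonneg 0≤1 0≤1) 2≉0)

      squares : ∀ x y z t → 0# ≤ (x * x + y * y) + (z * z + t * t)
      squares x y z t = +-nonneg (normSq-nonneg (x +i y)) (normSq-nonneg (z +i t))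

      plus : ∀ p q r s → 0# ≤ (p * p + q * q) + (r * r + s * s) + (p * r + q * s)
      plus p q r s = halve (≤-resp-≈ refl
        (solve 4 (λ p q r s →
          (p :* p :+ q :* q) :+ (r :* r :+ s :* s)
            :+ ((p :+ r) :* (p :+ r) :+ (q :+ s) :* (q :+ s))
          := con (+ 2) :* ((p :* p :+ q :* q) :+ (r :* r :+ s :* s) :+ (p :* r :+ q :* s)))
          refl p q r s)
        (+-nonneg (squares p q r s) (normSq-nonneg ((p + r) +i (q + s)))))

      minus : ∀ p q r s → 0# ≤ (p * p + q * q) + (r * r + s * s) - (p * r + q * s)
      minus p q r s = halve (≤-resp-≈ refl
        (solve 4 (λ p q r s →
          (p :* p :+ q :* q) :+ (r :* r :+ s :* s)
            :+ ((p :- r) :* (p :- r) :+ (q :- s) :* (q :- s))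
          := con (+ 2) :* ((p :* p :+ q :* q) :+ (r :* r :+ s :* s) :- (p :* r :+ q :* s)))
          refl p q r s)
        (+-nonneg (squares p q r s) (normSq-nonneg ((p - r) +i (q - s)))))

    Meanᶜ : (G → ℂ) → ℂ → Set
    Meanᶜ f m = Mean (re ∘ f) (re m) × Mean (im ∘ f) (im m)

    -- The forms Ψ as means, and their behaviour along `M ⊕ α · N`.

    module _ (L : G → ℂ) where

      open Weighted w L

      opaque
        unfolding 𝔼

        -- The two sums in `𝔼` evaluate to W m and W; multiplying their quotient back by the second
        -- and cancelling W gives m.
        𝔼-Meanᶜ : ∀ {f m} → Meanᶜ f m → 𝔼 f ≈ᶜ m
        𝔼-Meanᶜ {f} {m} (mean-re , mean-im) =
            *-cancelˡ-≈ W≉0 (trans (sym re-TQ) (trans (proj₁ T*Q≈S) (proj₁ S≈)))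
          , *-cancelˡ-≈ W≉0 (trans (sym im-TQ) (trans (proj₂ T*Q≈S) (proj₂ S≈)))
          where
          W≉0 : ¬ (W ≈ 0#)
          W≉0 = <⇒≉ 0<W

          S T Q : ℂ
          S = ∑ (λ π → ofReal (w π) *ᶜ f π)
          T = ∑ (λ π → ofReal (w π))
          Q = S /ᶜ T

          S≈ : S ≈ᶜ ((W * re m) +i (W * im m))
          S≈ = ∑-HasSum (re∧im⇒HasSum
            (HasSumᵣ-cong (λ π → solve 3 (λ w x y → w :* x := w :* x :- con (+ 0) :* y) refl
              (w π) (re (f π)) (im (f π))) refl (weightedSum mean-re))
            (HasSumᵣ-cong (λ π → solve 3 (λ w x y → w :* y := w :* y :+ con (+ 0) :* x) refl
              (w π) (re (f π)) (im (f π))) refl (weightedSum mean-im)))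

          T≈ : T ≈ᶜ ofReal W
          T≈ = ∑-HasSum (re∧im⇒HasSum w-sum HasSumᵣ-0)

          T≉0 : ¬ (normSq T ≈ 0#)
          T≉0 h = W≉0 (trans (sym (proj₁ T≈)) (proj₁ (normSq≈0⇒≈0 {T} h)))

          T*Q≈S : T *ᶜ Q ≈ᶜ S
          T*Q≈S = *-/ᶜ-cancel S {T} T≉0

          re-TQ : re (T *ᶜ Q) ≈ W * re Q
          re-TQ = trans (+-cong (*-congʳ (proj₁ T≈)) (-‿cong (*-congʳ (proj₂ T≈))))
            (solve 3 (λ w x y → w :* x :- con (+ 0) :* y := w :* x) refl W (re Q) (im Q))

          im-TQ : im (T *ᶜ Q) ≈ W * im Q
          im-TQ = trans (+-cong (*-congʳ (proj₁ T≈)) (*-congʳ (proj₂ T≈)))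
            (solve 3 (λ w x y → w :* y :+ con (+ 0) :* x := w :* y) refl W (re Q) (im Q))

      Meanᶜ-𝔼 : ∀ {f} → ∃ (Meanᶜ f) → Meanᶜ f (𝔼 f)
      Meanᶜ-𝔼 {f} (m , mean-re , mean-im) =
          Mean-cong (λ _ → refl) (sym (proj₁ 𝔼≈m)) mean-re
        , Mean-cong (λ _ → refl) (sym (proj₂ 𝔼≈m)) mean-im
        where 𝔼≈m = 𝔼-Meanᶜ {f} {m} (mean-re , mean-im)

      SquareMean : (G → ℂ) → Set
      SquareMean M = ∃ (Mean (λ π → normSq (L π *ᶜ M π)))

      SquareSummable⇒SquareMean : ∀ {M} → SquareSummable M → SquareMean M
      SquareSummable⇒SquareMean {M} (s , hs) = sum⇒Mean {λ π → normSq (L π *ᶜ M π)}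
        (re s , HasSumᵣ-cong (λ π → *-congˡ (∣∣^2 (L π *ᶜ M π))) refl (HasSum⇒re hs))

      -- Square integrability implies integrability because constants have a mean: the two
      -- coordinates are dot products with (1, 0) and (0, 1).
      Ψ₁-Mean : ∀ {M} → SquareMean M → Meanᶜ (λ π → L π *ᶜ M π) (Ψ₁ M)
      Ψ₁-Mean {M} (_ , mean) = Meanᶜ-𝔼 {x}
        ( (proj₁ mean-re +i proj₁ mean-im)
        , Mean-cong (λ π → solve 2 (λ a b → a :* con (+ 1) :+ b :* con (+ 0) := a) refl
            (re (x π)) (im (x π))) refl (proj₂ mean-re)
        , Mean-cong (λ π → solve 2 (λ a b → a :* con (+ 0) :+ b :* con (+ 1) := b) refl
            (re (x π)) (im (x π))) refl (proj₂ mean-im))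
        where
        x : G → ℂ
        x π = L π *ᶜ M π
        mean-re = Mean-dot {re ∘ x} {im ∘ x} {λ _ → 1#} {λ _ → 0#} mean (Mean-const _)
        mean-im = Mean-dot {re ∘ x} {im ∘ x} {λ _ → 0#} {λ _ → 1#} mean (Mean-const _)

      -- The real and imaginary parts of x ȳ are the dot products of x with y and with i y.
      Ψ₂-Mean : ∀ {M N} → SquareMean M → SquareMean N →
                Meanᶜ (λ π → (L π *ᶜ M π) *ᶜ conj (L π *ᶜ N π)) (Ψ₂ M N)
      Ψ₂-Mean {M} {N} (_ , mean-x) (_ , mean-y) = Meanᶜ-𝔼 {λ π → x π *ᶜ conj (y π)}
        ( (proj₁ mean-re +i proj₁ mean-im)
        , Mean-cong (λ π → solve 4 (λ a b c d → a :* c :+ b :* d := a :* c :- b :* (:- d)) refl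
            (re (x π)) (im (x π)) (re (y π)) (im (y π))) refl (proj₂ mean-re)
        , proj₂ mean-im)
        where
        x y : G → ℂ
        x π = L π *ᶜ M π
        y π = L π *ᶜ N π
        mean-re = Mean-dot {re ∘ x} {im ∘ x} {re ∘ y} {im ∘ y} mean-x mean-y
        mean-im = Mean-dot {re ∘ x} {im ∘ x} {λ π → - im (y π)} {re ∘ y} mean-x
          (Mean-cong (λ π → solve 2 (λ c d → c :* c :+ d :* d := :- d :* :- d :+ c :* c) refl
            (re (y π)) (im (y π))) refl mean-y)

      Ψᵣ-Mean : ∀ {M} → SquareMean M → Mean (λ π → normSq (L π *ᶜ M π)) (Ψᵣ M)
      Ψᵣ-Mean {M} sm = Mean-cong (λ π → solve 2 (λ a b → a :* a :- b :* (:- b) := a :* a :+ b :* b) refl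
        (re (L π *ᶜ M π)) (im (L π *ᶜ M π))) refl (proj₁ (Ψ₂-Mean sm sm))

      im-Ψ₂≈0 : ∀ {M} → SquareMean M → im (Ψ₂ M M) ≈ 0#
      im-Ψ₂≈0 {M} sm = Mean-unique (proj₂ (Ψ₂-Mean sm sm))
        (Mean-cong (λ π → solve 2 (λ a b → con (+ 0) := a :* (:- b) :+ b :* a) refl
          (re (L π *ᶜ M π)) (im (L π *ᶜ M π))) refl (Mean-const 0#))

      -- The variance 𝔼 |x - 𝔼 x|² is nonnegative.
      cauchy-schwarz : ∀ {M} → SquareMean M → normSq (Ψ₁ M) ≤ Ψᵣ M
      cauchy-schwarz {M} sm = difference-nonneg
        (solve 3 (λ c d q → q :- (c :* c :+ d :* d)
          := q :+ (:- (con (+ 2) :* c) :* c :+ (:- (con (+ 2) :* d) :* d :+ (c :* c :+ d :* d)))) refl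
          (re c) (im c) (Ψᵣ M))
        (Mean-nonneg (λ π → ≤-resp-≈ refl
            (solve 4 (λ a b c d → (a :- c) :* (a :- c) :+ (b :- d) :* (b :- d)
              := (a :* a :+ b :* b) :+ (:- (con (+ 2) :* c) :* a
                 :+ (:- (con (+ 2) :* d) :* b :+ (c :* c :+ d :* d)))) refl
              (re (x π)) (im (x π)) (re c) (im c))
            (normSq-nonneg (x π -ᶜ c)))
          (Mean-+ (Ψᵣ-Mean sm)
            (Mean-+ (Mean-* (- ((1# + 1#) * re c)) (proj₁ (Ψ₁-Mean sm)))
              (Mean-+ (Mean-* (- ((1# + 1#) * im c)) (proj₂ (Ψ₁-Mean sm)))
                (Mean-const (normSq c))))))
        where
        c = Ψ₁ M
        x : G → ℂ
        x π = L π *ᶜ M π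

      -- The expansion of ‖u + αv‖², with the cross term 2 Re(ᾱ⟨u, v⟩) in coordinates.
      Q : (G → ℂ) → (G → ℂ) → ℂ → ℝ
      Q M N α = Ψᵣ M + ((1# + 1#) * (re α * re (Ψ₂ M N) + im α * im (Ψ₂ M N)) + normSq α * Ψᵣ N)

      -- Provides both the square integrability of `M ⊕ α · N` and the value of its `Ψᵣ`.
      Q-Mean : ∀ {M N} α → SquareMean M → SquareMean N →
               Mean (λ π → normSq (L π *ᶜ (M ⊕ α · N) π)) (Q M N α)
      Q-Mean {M} {N} α sM sN = Mean-cong
        (λ π → solve 8 (λ l l′ m m′ n n′ α α′ →
            let z = l :+i l′ ; x = z :*ᶜ (m :+i m′) ; y = z :*ᶜ (n :+i n′) ; a = α :+i α′
                xy = x :*ᶜ :conj y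
            in :normSq x :+ (con (+ 2) :* (α :* :re xy :+ α′ :* :im xy) :+ :normSq a :* :normSq y)
               := :normSq (z :*ᶜ ((m :+i m′) :+ᶜ a :*ᶜ (n :+i n′)))) refl
          (re (L π)) (im (L π)) (re (M π)) (im (M π)) (re (N π)) (im (N π)) (re α) (im α))
        refl
        (Mean-+ (Ψᵣ-Mean sM)
          (Mean-+ (Mean-* (1# + 1#)
              (Mean-+ (Mean-* (re α) (proj₁ (Ψ₂-Mean sM sN))) (Mean-* (im α) (proj₂ (Ψ₂-Mean sM sN)))))
            (Mean-* (normSq α) (Ψᵣ-Mean sN))))

      ⊕-SquareMean : ∀ {M N} α → SquareMean M → SquareMean N → SquareMean (M ⊕ α · N)
      ⊕-SquareMean α sM sN = _ , Q-Mean α sM sN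

      Ψᵣ-⊕ : ∀ {M N} α → SquareMean M → SquareMean N → Ψᵣ (M ⊕ α · N) ≈ Q M N α
      Ψᵣ-⊕ α sM sN = Mean-unique (Ψᵣ-Mean (⊕-SquareMean α sM sN)) (Q-Mean α sM sN)

      Ψ₁-⊕ : ∀ {M N} α → SquareMean M → SquareMean N → Ψ₁ (M ⊕ α · N) ≈ᶜ Ψ₁ M +ᶜ α *ᶜ Ψ₁ N
      Ψ₁-⊕ {M} {N} α sM sN =
          Mean-unique (proj₁ means) (Mean-cong
            (λ π → solve 8 (λ l l′ m m′ n n′ α α′ →
              let z = l :+i l′ ; x = z :*ᶜ (m :+i m′) ; y = z :*ᶜ (n :+i n′) ; a = α :+i α′
              in :re x :+ (α :* :re y :+ :- α′ :* :im y) := :re (z :*ᶜ ((m :+i m′) :+ᶜ a :*ᶜ (n :+i n′)))) refl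
              (re (L π)) (im (L π)) (re (M π)) (im (M π)) (re (N π)) (im (N π)) (re α) (im α))
            (solve 5 (λ x a b c d → x :+ (a :* c :+ :- b :* d) := x :+ (a :* c :- b :* d)) refl
              (re (Ψ₁ M)) (re α) (im α) (re (Ψ₁ N)) (im (Ψ₁ N)))
            (Mean-+ (proj₁ (Ψ₁-Mean sM)) (Mean-+ (Mean-* (re α) (proj₁ (Ψ₁-Mean sN)))
               (Mean-* (- im α) (proj₂ (Ψ₁-Mean sN))))))
        , Mean-unique (proj₂ means) (Mean-cong
            (λ π → solve 8 (λ l l′ m m′ n n′ α α′ →
              let z = l :+i l′ ; x = z :*ᶜ (m :+i m′) ; y = z :*ᶜ (n :+i n′) ; a = α :+i α′
              in :im x :+ (α :* :im y :+ α′ :* :re y) := :im (z :*ᶜ ((m :+i m′) :+ᶜ a :*ᶜ (n :+i n′)))) refl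
              (re (L π)) (im (L π)) (re (M π)) (im (M π)) (re (N π)) (im (N π)) (re α) (im α))
            refl
            (Mean-+ (proj₂ (Ψ₁-Mean sM)) (Mean-+ (Mean-* (re α) (proj₂ (Ψ₁-Mean sN)))
               (Mean-* (im α) (proj₁ (Ψ₁-Mean sN))))))
        where
        means = Ψ₁-Mean (⊕-SquareMean α sM sN)

  -- Polynomial identities for the Gram matrix of u and v.

  module GramIdentities (a b c : ℂ) (A B : ℝ) where

    -- These are `numerator` and `denominator` with real diagonal entries A and B, which makes the
    -- identities below polynomial in real variables.
    num den : ℂ
    num = conj a *ᶜ c -ᶜ conj b *ᶜ ofReal A
    den = conj b *ᶜ conj c -ᶜ conj a *ᶜ ofReal B

    g t : ℝ
    g = A * B - normSq c
    t = normSq b * A + normSq a * B - (1# + 1#) * re (conj a *ᶜ b *ᶜ c)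

    q : ℂ → ℝ
    q α = A + ((1# + 1#) * (re α * re c + im α * im c) + normSq α * B)

    private
      module Symbolic {n : ℕ} (a₁ a₂ b₁ b₂ c₁ c₂ A B : Polynomial n) where
        a′ = a₁ :+i a₂
        b′ = b₁ :+i b₂
        c′ = c₁ :+i c₂
        num′ = :conj a′ :*ᶜ c′ :-ᶜ :conj b′ :*ᶜ :ofReal A
        den′ = :conj b′ :*ᶜ :conj c′ :-ᶜ :conj a′ :*ᶜ :ofReal B
        g′ = A :* B :- :normSq c′
        t′ = :normSq b′ :* A :+ :normSq a′ :* B :- con (+ 2) :* :re (:conj a′ :*ᶜ b′ :*ᶜ c′)
        q′ = λ α → A :+ (con (+ 2) :* (:re α :* c₁ :+ :im α :* c₂) :+ :normSq α :* B)

    -- With u and v vectors whose Gram matrix is (A, c; c̄, B), and e′ the combination of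
    -- u and v with ⟨u, e′⟩ = a and ⟨v, e′⟩ = b, one has ‖e′‖² = t / g; divided by g,
    -- the identity gives the Gram determinant of e′ and u + α v.
    t*q : ∀ α → t * q α ≈ g * normSq (a +ᶜ α *ᶜ b) + normSq (den *ᶜ α -ᶜ num)
    t*q α = solve 10 (λ a₁ a₂ b₁ b₂ c₁ c₂ A B x y →
      let open Symbolic a₁ a₂ b₁ b₂ c₁ c₂ A B
          α′ = x :+i y
      in t′ :* q′ α′ := g′ :* :normSq (a′ :+ᶜ α′ :*ᶜ b′) :+ :normSq (den′ :*ᶜ α′ :-ᶜ num′)) refl
      (re a) (im a) (re b) (im b) (re c) (im c) A B (re α) (im α)

    -- Divided by A g, this expresses the gain of the projection onto span(u, v) over that onto the
    -- line of u; `B*t` does the same for v.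
    A*t : A * t ≈ g * normSq a + normSq num
    A*t = solve 8 (λ a₁ a₂ b₁ b₂ c₁ c₂ A B →
      let open Symbolic a₁ a₂ b₁ b₂ c₁ c₂ A B
      in A :* t′ := g′ :* :normSq a′ :+ :normSq num′) refl
      (re a) (im a) (re b) (im b) (re c) (im c) A B

    B*t : B * t ≈ g * normSq b + normSq den
    B*t = solve 8 (λ a₁ a₂ b₁ b₂ c₁ c₂ A B →
      let open Symbolic a₁ a₂ b₁ b₂ c₁ c₂ A B
      in B :* t′ := g′ :* :normSq b′ :+ :normSq den′) refl
      (re a) (im a) (re b) (im b) (re c) (im c) A B

    -- Completing the square in α.
    B*q : ∀ α → B * q α ≈ normSq (c +ᶜ α *ᶜ ofReal B) + g
    B*q α = solve 6 (λ c₁ c₂ A B x y →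
      -- The identity involves only c, A, B and α, so `c` fills the slots of `a` and `b`.
      let open Symbolic c₁ c₂ c₁ c₂ c₁ c₂ A B
          α′ = x :+i y
      in B :* q′ α′ := :normSq (c′ :+ᶜ α′ :*ᶜ :ofReal B) :+ g′) refl
      (re c) (im c) A B (re α) (im α)

    -- The left argument is the complex conjugate of `den`, and is the form in which (ii) bounds the
    -- denominator from below.
    normSq-den : normSq (b *ᶜ c -ᶜ a *ᶜ ofReal B) ≈ normSq den
    normSq-den = solve 8 (λ a₁ a₂ b₁ b₂ c₁ c₂ A B →
      let open Symbolic a₁ a₂ b₁ b₂ c₁ c₂ A B
      in :normSq (b′ :*ᶜ c′ :-ᶜ a′ :*ᶜ :ofReal B) := :normSq den′) refl
      (re a) (im a) (re b) (im b) (re c) (im c) A B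

    -- The case α = - c / B, which makes u + α v orthogonal to v.
    den≤B*g : ¬ (B ≈ 0#) → 0# ≤ B → (∀ α → normSq (a +ᶜ α *ᶜ b) ≤ q α) → normSq den ≤ B * g
    den≤B*g B≉0 0≤B le = begin
      normSq den                        ≈⟨ den≈ ⟩
      B * B * normSq (a +ᶜ α *ᶜ b)      ≤⟨ *-monoˡ-≤ (square-nonneg B) (le α) ⟩
      B * B * q α                       ≈⟨ *-assoc B B (q α) ⟩
      B * (B * q α)                     ≈⟨ *-congˡ (B*q α) ⟩
      B * (normSq (c +ᶜ α *ᶜ ofReal B) + g)  ≈⟨ *-congˡ (trans (+-congʳ c+αB≈0) (+-identityˡ g)) ⟩
      B * g                             ∎
      where
      α : ℂ
      α = (- re c * B ⁻¹) +i (- im c * B ⁻¹)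

      B*B⁻¹≈1 = *-inverseʳ B B≉0

      c+αB≈0 : normSq (c +ᶜ α *ᶜ ofReal B) ≈ 0#
      c+αB≈0 = trans
        -- With i = B⁻¹ as a free variable the value is |c|² (1 - B i)²; only afterwards is B i = 1
        -- used.
        (solve 4 (λ c₁ c₂ B i →
          let c′ = c₁ :+i c₂ ; α′ = (:- c₁ :* i) :+i (:- c₂ :* i)
          in :normSq (c′ :+ᶜ α′ :*ᶜ :ofReal B)
             := :normSq c′ :* ((con (+ 1) :- B :* i) :* (con (+ 1) :- B :* i))) refl
          (re c) (im c) B (B ⁻¹))
        (trans (*-congˡ (trans (*-congʳ 1-BB⁻¹≈0) (zeroˡ _))) (zeroʳ _))
        where
        1-BB⁻¹≈0 : 1# - B * B ⁻¹ ≈ 0#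
        1-BB⁻¹≈0 = trans (+-congˡ (-‿cong B*B⁻¹≈1)) (-‿inverseʳ 1#)

      den≈ : normSq den ≈ B * B * normSq (a +ᶜ α *ᶜ b)
      den≈ = begin-equality
        normSq den                                          ≈⟨ normSq-den ⟨
        -- A factor B B⁻¹ is inserted in front of the product of b and c, after which the equality
        -- is polynomial in B and B⁻¹.
        normSq (b *ᶜ c -ᶜ a *ᶜ ofReal B)                    ≈⟨ normSq-cong {z} {u}
            ( +-cong (sym (times1 _)) refl , +-cong (sym (times1 _)) refl ) ⟩
        normSq u                                            ≈⟨
          solve 8 (λ a₁ a₂ b₁ b₂ c₁ c₂ B i →
            let a′ = a₁ :+i a₂ ; b′ = b₁ :+i b₂ ; c′ = c₁ :+i c₂
                α′ = (:- c₁ :* i) :+i (:- c₂ :* i)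
                bc = b′ :*ᶜ c′ ; aB = a′ :*ᶜ :ofReal B
            in :normSq ((B :* i :* :re bc :- :re aB) :+i (B :* i :* :im bc :- :im aB))
               := B :* B :* :normSq (a′ :+ᶜ α′ :*ᶜ b′)) refl
            (re a) (im a) (re b) (im b) (re c) (im c) B (B ⁻¹) ⟩
        B * B * normSq (a +ᶜ α *ᶜ b)                        ∎
        where
        z u : ℂ
        z = b *ᶜ c -ᶜ a *ᶜ ofReal B
        u = (B * B ⁻¹ * re (b *ᶜ c) - re (a *ᶜ ofReal B)) +i (B * B ⁻¹ * im (b *ᶜ c) - im (a *ᶜ ofReal B))
        times1 : ∀ x → B * B ⁻¹ * x ≈ x
        times1 x = trans (*-congʳ B*B⁻¹≈1) (*-identityˡ x)

  -- Estimates of the gains as inequalities between real numbers.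

  -- P and R stand for |a|² and |b|², n and d for |num|² and |den|², β, β′ for P / A and R / B.
  module RealEstimates {A B g t P R n d β β′ : ℝ}
    (0<A : 0# < A) (0<B : 0# < B) (0≤n : 0# ≤ n) (0≤d : 0# ≤ d) (0≤AB-g : 0# ≤ A * B - g)
    (A*β≈P : A * β ≈ P) (B*β′≈R : B * β′ ≈ R)
    (A*t≈ : A * t ≈ g * P + n) (B*t≈ : B * t ≈ g * R + d)
    (d≤B*g : d ≤ B * g) (β′≤β : β′ ≤ β) (0<β′ : 0# < β′) where

    0≤g : 0# ≤ g
    0≤g = *-cancelˡ-nonneg 0<B (≤-trans 0≤d d≤B*g)

    -- If g = 0, then d ≤ B g makes d vanish, so B t = 0, hence t = 0 and n = A t = 0.
    n≉0⇒0<g : ¬ (n ≈ 0#) → 0# < g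
    n≉0⇒0<g n≉0 = ≤∧≉⇒< 0≤g λ g≈0 →
      let d≈0 = antisym (≤-trans d≤B*g (≤-reflexive (trans (*-congˡ g≈0) (zeroʳ B)))) 0≤d
          g*x+y≈y = λ x y → trans (+-congʳ (trans (*-congʳ {x} g≈0) (zeroˡ x))) (+-identityˡ y)
          t≈0 = *-cancelˡ-≈0 (<⇒≉ 0<B) (trans B*t≈ (trans (g*x+y≈y R d) d≈0))
      in n≉0 (trans (sym (g*x+y≈y P n)) (trans (sym A*t≈) (trans (*-congˡ t≈0) (zeroʳ A))))

    A*[t-gβ]≈n : A * (t - g * β) ≈ n
    A*[t-gβ]≈n = begin-equality
      A * (t - g * β)          ≈⟨ solve 4 (λ A t g β → A :* (t :- g :* β) := A :* t :- g :* (A :* β)) refl A t g β ⟩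
      A * t - g * (A * β)      ≈⟨ +-cong A*t≈ (-‿cong (*-congˡ A*β≈P)) ⟩
      g * P + n - g * P        ≈⟨ solve 3 (λ g P n → g :* P :+ n :- g :* P := n) refl g P n ⟩
      n                        ∎

    B*[t-gβ′]≈d : B * (t - g * β′) ≈ d
    B*[t-gβ′]≈d = begin-equality
      B * (t - g * β′)         ≈⟨ solve 4 (λ A t g β → A :* (t :- g :* β) := A :* t :- g :* (A :* β)) refl B t g β′ ⟩
      B * t - g * (B * β′)     ≈⟨ +-cong B*t≈ (-‿cong (*-congˡ B*β′≈R)) ⟩
      g * R + d - g * R        ≈⟨ solve 3 (λ g P n → g :* P :+ n :- g :* P := n) refl g R d ⟩
      d                        ∎

    -- If d = 0, then t = g β′ ≤ g β, while A (t - g β) = n is nonnegative; together these give n =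
    -- 0.
    n≉0⇒d≉0 : ¬ (n ≈ 0#) → ¬ (d ≈ 0#)
    n≉0⇒d≉0 n≉0 d≈0 = n≉0 (trans (sym A*[t-gβ]≈n) (trans (*-congˡ t-gβ≈0) (zeroʳ A)))
      where
      t≈gβ′ : t - g * β′ ≈ 0#
      t≈gβ′ = *-cancelˡ-≈0 (<⇒≉ 0<B) (trans B*[t-gβ′]≈d d≈0)
      t-gβ≈0 : t - g * β ≈ 0#
      t-gβ≈0 = antisym
        (difference-nonneg
          (trans (solve 4 (λ t g β β′ → con (+ 0) :- (t :- g :* β) := g :* (β :- β′) :- (t :- g :* β′)) refl t g β β′)
            (trans (+-congˡ (-‿cong t≈gβ′)) (solve 1 (λ x → x :- con (+ 0) := x) refl _)))
          (*-nonneg 0≤g (x≤y⇒0≤y-x β′≤β)))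
        (*-cancelˡ-nonneg 0<A (≤-resp-≈ refl (sym A*[t-gβ]≈n) 0≤n))

    module _ {V : ℝ} (0<g : 0# < g) (g*V≈t : g * V ≈ t) where

      A*g*[V-β]≈n : A * g * (V - β) ≈ n
      A*g*[V-β]≈n = begin-equality
        A * g * (V - β)       ≈⟨ solve 4 (λ A g V β → A :* g :* (V :- β) := A :* (g :* V :- g :* β)) refl A g V β ⟩
        A * (g * V - g * β)   ≈⟨ *-congˡ (+-congʳ g*V≈t) ⟩
        A * (t - g * β)       ≈⟨ A*[t-gβ]≈n ⟩
        n                     ∎

      0≤V-β : 0# ≤ V - β
      0≤V-β = *-cancelˡ-nonneg (*-pos 0<A 0<g) (≤-resp-≈ refl (sym A*g*[V-β]≈n) 0≤n)

      -- Since g ≤ A B, the gain n / (A g) is at least n / (A² B), and β′ = R / B.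
      gain-lower : ∀ {e} → e * e * R * (A * A) ≤ n → e * e * β′ ≤ V - β
      gain-lower {e} h = *-cancelˡ-≤ (*-pos (*-pos 0<A 0<A) 0<B) (begin
        A * A * B * (e * e * β′)     ≈⟨ solve 4 (λ A B e β → A :* A :* B :* (e :* e :* β)
                                         := e :* e :* (B :* β) :* (A :* A)) refl A B e β′ ⟩
        e * e * (B * β′) * (A * A)   ≈⟨ *-congʳ (*-congˡ B*β′≈R) ⟩
        e * e * R * (A * A)          ≤⟨ h ⟩
        n                            ≈⟨ A*g*[V-β]≈n ⟨
        A * g * (V - β)              ≤⟨ difference-nonneg
                                         (solve 4 (λ A B g x → A :* A :* B :* x :- A :* g :* x
                                           := A :* ((A :* B :- g) :* x)) refl A B g (V - β))
                                         (*-nonneg (proj₁ 0<A) (*-nonneg 0≤AB-g 0≤V-β)) ⟩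
        A * A * B * (V - β)          ∎)

      -- The lower bound on d and d ≤ B g give e B P ≤ g, so the gain n / (A g) is at most e R A /
      -- (B P) = e β′ / β.
      gain-upper : ∀ {e} → 0# < e → n ≤ e * e * R * (A * A) → e * (B * B) * P ≤ d →
                   V - β ≤ e * (β′ / β)
      gain-upper {e} 0<e n≤ ≤d = *-cancelˡ-≤ 0<c (begin
        c * (V - β)                             ≈⟨ solve 5 (λ A B e β x →
                                                     e :* (A :* A) :* B :* β :* x := A :* (e :* B :* (A :* β)) :* x)
                                                     refl A B e β (V - β) ⟩
        A * (e * B * (A * β)) * (V - β)         ≈⟨ *-congʳ (*-congˡ (*-congˡ A*β≈P)) ⟩
        A * (e * B * P) * (V - β)               ≤⟨ *-monoʳ 0≤V-β (*-monoˡ-≤ (proj₁ 0<A) eBP≤g) ⟩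
        A * g * (V - β)                         ≈⟨ A*g*[V-β]≈n ⟩
        n                                       ≤⟨ n≤ ⟩
        e * e * R * (A * A)                     ≈⟨ *-congʳ (*-congˡ (sym B*β′≈R)) ⟩
        e * e * (B * β′) * (A * A)              ≈⟨ *-congʳ (*-congˡ (*-congˡ (sym (*-/-cancel β′ (<⇒≉ 0<β))))) ⟩
        e * e * (B * (β * (β′ / β))) * (A * A)  ≈⟨ solve 5 (λ A B e β y →
                                                     e :* e :* (B :* (β :* y)) :* (A :* A)
                                                     := e :* (A :* A) :* B :* β :* (e :* y))
                                                     refl A B e β (β′ / β) ⟩
        c * (e * (β′ / β))                      ∎)
        where
        0<β : 0# < β
        0<β = <-≤-trans 0<β′ β′≤β
        -- This is A times the lower bound e B P of g, with P written as A β.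
        c : ℝ
        c = e * (A * A) * B * β
        0<c : 0# < c
        0<c = *-pos (*-pos (*-pos 0<e (*-pos 0<A 0<A)) 0<B) 0<β
        *-monoʳ : ∀ {x y z} → 0# ≤ z → x ≤ y → x * z ≤ y * z
        *-monoʳ {x} {y} {z} 0≤z x≤y = ≤-resp-≈ (*-comm z x) (*-comm z y) (*-monoˡ-≤ 0≤z x≤y)
        eBP≤g : e * B * P ≤ g
        eBP≤g = *-cancelˡ-≤ 0<B (≤-trans
          (≤-resp-≈ (solve 3 (λ B e P → e :* (B :* B) :* P := B :* (e :* B :* P)) refl B e P) refl ≤d)
          d≤B*g)

  -- Maximising `β` over `M ⊕ α · N`, and the two cases.

  module Theorem {G : Set} (L : G → ℂ) (w : G → ℝ) (w-nonneg : ∀ π → 0# ≤ w π)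
    {W : ℝ} (w-sum : HasSumᵣ w W) (0<W : 0# < W) where

    open Weighted w L
    open Means w w-nonneg w-sum 0<W

    Ψᵣ≈0⇒Ψ₂≈0 : ∀ {M} → SquareMean L M → Ψᵣ M ≈ 0# → Ψ₂ M M ≈ᶜ 0ᶜ
    Ψᵣ≈0⇒Ψ₂≈0 sM h = h , im-Ψ₂≈0 L sM

    -- A division-free description of `β`. It covers the default value 0 too, since Cauchy-Schwarz
    -- makes `Ψ₁ M` vanish together with `Ψ₂ M M`.
    β-spec : ∀ {M} → SquareMean L M → Ψᵣ M * β M ≈ normSq (Ψ₁ M)
    β-spec {M} sM with em {Ψ₂ M M ≈ᶜ 0ᶜ}
    ... | yes (Ψᵣ≈0 , _) = trans (zeroʳ _)
      (antisym (normSq-nonneg (Ψ₁ M)) (≤-resp-≈ refl Ψᵣ≈0 (cauchy-schwarz L sM)))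
    ... | no Ψ₂≉0 = trans (*-/-cancel _ (λ h → Ψ₂≉0 (Ψᵣ≈0⇒Ψ₂≈0 sM h))) (∣∣^2 (Ψ₁ M))

    0≤Ψᵣ : ∀ {M} → SquareMean L M → 0# ≤ Ψᵣ M
    0≤Ψᵣ {M} sM = ≤-trans (normSq-nonneg (Ψ₁ M)) (cauchy-schwarz L sM)

    0<β⇒0<Ψᵣ : ∀ {M} → SquareMean L M → 0# < β M → 0# < Ψᵣ M
    0<β⇒0<Ψᵣ {M} sM 0<β = ≤∧≉⇒< (0≤Ψᵣ sM) (λ h → <⇒≉ 0<β (β≈0 h))
      where
      β≈0 : Ψᵣ M ≈ 0# → β M ≈ 0#
      β≈0 Ψᵣ≈0 with em {Ψ₂ M M ≈ᶜ 0ᶜ}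
      ... | yes _    = refl
      ... | no  Ψ₂≉0 = contradiction (Ψᵣ≈0⇒Ψ₂≈0 sM Ψᵣ≈0) Ψ₂≉0

    module _ {M N : G → ℂ} (sM : SquareMean L M) (sN : SquareMean L N)
             (βN≤βM : β N ≤ β M) (0<βN : 0# < β N) where

      open Maximum M N

      private
        a b c : ℂ
        a = Ψ₁ M
        b = Ψ₁ N
        c = Ψ₂ M N
        A B : ℝ
        A = Ψᵣ M
        B = Ψᵣ N

      open GramIdentities a b c A B

      0<βM : 0# < β M
      0<βM = <-≤-trans 0<βN βN≤βM

      0<A : 0# < A
      0<A = 0<β⇒0<Ψᵣ sM 0<βM

      0<B : 0# < B
      0<B = 0<β⇒0<Ψᵣ sN 0<βN

      numerator≈ : numerator ≈ᶜ num
      numerator≈ = +-congˡ (-‿cong (+-congˡ (-‿cong (*-congˡ im≈0)))) , +-congˡ (-‿cong (+-congʳ (*-congˡ im≈0)))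
        where im≈0 = im-Ψ₂≈0 L sM

      denominator≈ : denominator ≈ᶜ den
      denominator≈ = +-congˡ (-‿cong (+-congˡ (-‿cong (*-congˡ im≈0)))) , +-congˡ (-‿cong (+-congʳ (*-congˡ im≈0)))
        where im≈0 = im-Ψ₂≈0 L sN

      ∣numerator∣ : ∣ numerator ∣ * ∣ numerator ∣ ≈ normSq num
      ∣numerator∣ = trans (∣∣*∣∣ numerator) (normSq-cong {numerator} {num} numerator≈)

      gram≈g : gram ≈ g
      gram≈g = +-congˡ (-‿cong (∣∣^2 c))

      -- Cauchy-Schwarz for u + αv and the constant 1, in terms of the Gram data.
      normSq≤q : ∀ α → normSq (a +ᶜ α *ᶜ b) ≤ q α
      normSq≤q α = ≤-resp-≈
        (normSq-cong {Ψ₁ (M ⊕ α · N)} {a +ᶜ α *ᶜ b} (Ψ₁-⊕ L α sM sN)) (Ψᵣ-⊕ L α sM sN)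
        (cauchy-schwarz L (⊕-SquareMean L α sM sN))

      open RealEstimates {A} {B} {g} {t} {normSq a} {normSq b} {normSq num} {normSq den} {β M} {β N}
        0<A 0<B (normSq-nonneg num) (normSq-nonneg den)
        (≤-resp-≈ refl (solve 2 (λ x y → y := x :- (x :- y)) refl (A * B) (normSq c)) (normSq-nonneg c))
        (β-spec sM) (β-spec sN) A*t B*t
        (den≤B*g (<⇒≉ 0<B) (proj₁ 0<B) normSq≤q) βN≤βM 0<βN

      module _ (0<g : 0# < g) (den≉0 : ¬ (normSq den ≈ 0#)) where

        βα : ℂ → ℝ
        βα α = β (M ⊕ α · N)

        q*βα : ∀ α → q α * βα α ≈ normSq (a +ᶜ α *ᶜ b)
        q*βα α = trans (*-congʳ (sym (Ψᵣ-⊕ L α sM sN)))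
          (trans (β-spec (⊕-SquareMean L α sM sN))
            (normSq-cong {Ψ₁ (M ⊕ α · N)} {a +ᶜ α *ᶜ b} (Ψ₁-⊕ L α sM sN)))

        -- By `B*q`, B q α is a square plus g, so u + αv is never null.
        0<q : ∀ α → 0# < q α
        0<q α = *-cancelˡ-nonneg 0<B (proj₁ 0<Bq) , λ 0≈q → proj₂ 0<Bq (sym (trans (*-congˡ (sym 0≈q)) (zeroʳ B)))
          where
          0<Bq : 0# < B * q α
          0<Bq = <-≤-trans 0<g (difference-nonneg
            (trans (+-congʳ (B*q α)) (solve 2 (λ x g → x :+ g :- g := x) refl _ g))
            (normSq-nonneg (c +ᶜ α *ᶜ ofReal B)))

        -- After division by g q α, the shortfall of `βα α` from t / g is a nonnegative quantity
        -- that vanishes when den α = num. This yields both the bound and the maximiser.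
        q*[t-gβα] : ∀ α → q α * (t - g * βα α) ≈ normSq (den *ᶜ α -ᶜ num)
        q*[t-gβα] α = begin-equality
          q α * (t - g * βα α)    ≈⟨ solve 4 (λ q t g β →
              q :* (t :- g :* β) := t :* q :- g :* (q :* β)) refl (q α) t g (βα α) ⟩
          t * q α - g * (q α * βα α)  ≈⟨ +-cong (t*q α) (-‿cong (*-congˡ (q*βα α))) ⟩
          g * p + r - g * p       ≈⟨ solve 3 (λ g p r → g :* p :+ r :- g :* p := r) refl g p r ⟩
          r                       ∎
          where
          p = normSq (a +ᶜ α *ᶜ b)
          r = normSq (den *ᶜ α -ᶜ num)

        denominator≉0 : ¬ (normSq denominator ≈ 0#)
        denominator≉0 h = den≉0 (trans (sym (normSq-cong {denominator} {den} denominator≈)) h)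

        den*α₁≈num : den *ᶜ α₁ ≈ᶜ num
        den*α₁≈num = ≈ᶜ-trans {den *ᶜ α₁} {denominator *ᶜ α₁} {num}
          ( +-cong (*-congʳ (sym (proj₁ denominator≈))) (-‿cong (*-congʳ (sym (proj₂ denominator≈))))
          , +-cong (*-congʳ (sym (proj₁ denominator≈))) (*-congʳ (sym (proj₂ denominator≈))))
          (≈ᶜ-trans {denominator *ᶜ α₁} {numerator} {num}
            (*-/ᶜ-cancel numerator {denominator} denominator≉0) numerator≈)

        V : ℝ
        V = βα α₁

        g*V≈t : g * V ≈ t
        g*V≈t = sym (begin-equality
          t                    ≈⟨ solve 2 (λ t x → t := t :- x :+ x) refl t (g * V) ⟩
          t - g * V + g * V    ≈⟨ +-congʳ (*-cancelˡ-≈0 (<⇒≉ (0<q α₁)) (trans (q*[t-gβα] α₁) residual≈0)) ⟩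
          0# + g * V           ≈⟨ +-identityˡ _ ⟩
          g * V                ∎)
          where
          residual≈0 : normSq (den *ᶜ α₁ -ᶜ num) ≈ 0#
          residual≈0 = trans (normSq-cong {den *ᶜ α₁ -ᶜ num} {num -ᶜ num}
              (+-congʳ (proj₁ den*α₁≈num) , +-congʳ (proj₂ den*α₁≈num)))
            (solve 2 (λ x y → (x :- x) :* (x :- x) :+ (y :- y) :* (y :- y) := con (+ 0)) refl (re num) (im num))

        maximal : ∀ α → βα α ≤ V
        maximal α = *-cancelˡ-≤ 0<g (≤-resp-≈ refl (sym g*V≈t)
          (0≤y-x⇒x≤y (*-cancelˡ-nonneg (0<q α) (≤-resp-≈ refl (sym (q*[t-gβα] α)) (normSq-nonneg (den *ᶜ α -ᶜ num))))))

        conclusion : Conclusion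
        conclusion =
            (λ d≈0 → denominator≉0 (trans (normSq-cong {denominator} {0ᶜ} d≈0)
              (solve 0 (con (+ 0) :* con (+ 0) :+ con (+ 0) :* con (+ 0) := con (+ 0)) refl)))
          , maximal
          , 0<gram
          , *-pos 0<A 0<gram
          , /-unique (<⇒≉ 0<gram) (trans (*-congʳ gram≈g) (trans g*V≈t
              (+-congʳ (+-cong (*-congʳ (sym (∣∣^2 b))) (*-congʳ (sym (∣∣^2 a)))))))
          , trans (solve 2 (λ V β → V := β :+ (V :- β)) refl V (β M))
              (+-congˡ (/-unique (<⇒≉ (*-pos 0<A 0<gram)) (begin-equality
                A * gram * (V - β M)  ≈⟨ *-congʳ (*-congˡ gram≈g) ⟩
                A * g * (V - β M)     ≈⟨ A*g*[V-β]≈n 0<g g*V≈t ⟩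
                normSq num            ≈⟨ ∣numerator∣ ⟨
                ∣ numerator ∣ * ∣ numerator ∣  ≈⟨ x^2≈x*x ∣ numerator ∣ ⟨
                ∣ numerator ∣ ^ 2     ∎)))
          where
          0<gram : 0# < gram
          0<gram = ≤-resp-≈ refl (sym gram≈g) (proj₁ 0<g) , λ h → proj₂ 0<g (trans h gram≈g)

      module _ {δ : ℝ} (0<δ : 0# < δ) where

        δ²≈ : δ ^ 2 ≈ δ * δ
        δ²≈ = x^2≈x*x δ

        0<δ*δ : 0# < δ * δ
        0<δ*δ = *-pos 0<δ 0<δ

        δ⁴≈ : δ ^ 4 ≈ δ * δ * (δ * δ)
        δ⁴≈ = solve 1 (λ x → x :* (x :* (x :* (x :* con (+ 1)))) := x :* x :* (x :* x)) refl δ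

        -- The bound on the modulus of `numerator` that separates (i) from (ii).
        threshold : ℝ
        threshold = δ ^ 2 * ∣ Ψ₁ N ∣ * Ψᵣ M

        0≤threshold : 0# ≤ threshold
        0≤threshold = *-nonneg (*-nonneg (≤-resp-≈ refl (sym δ²≈) (proj₁ 0<δ*δ)) (∣∣-nonneg b)) (proj₁ 0<A)

        threshold² : threshold * threshold ≈ δ * δ * (δ * δ) * normSq b * (A * A)
        threshold² = trans (*-cong (*-congʳ (*-congʳ δ²≈)) (*-congʳ (*-congʳ δ²≈)))
          (trans (solve 3 (λ e x A → e :* x :* A :* (e :* x :* A) := e :* e :* (x :* x) :* (A :* A)) refl
            (δ * δ) ∣ b ∣ A)
            (*-congʳ (*-congˡ (∣∣*∣∣ b))))

        -- As `0# < β N` forces Ψ_N ≠ 0, the threshold is positive and `num` is nonzero, which gives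
        -- g > 0 and `den` nonzero. Then `gain-lower` applies with e = δ².
        case-i : threshold ≤ ∣ numerator ∣ → Conclusion × δ ^ 4 * β N ≤ β (M ⊕ α₁ · N) - β M
        case-i h = conclusion 0<g den≉0
          , ≤-resp-≈ (*-congʳ (sym δ⁴≈)) refl (gain-lower 0<g (g*V≈t 0<g den≉0) {δ * δ} n≥)
          where
          n≥ : δ * δ * (δ * δ) * normSq b * (A * A) ≤ normSq num
          n≥ = ≤-resp-≈ threshold² ∣numerator∣ (square-mono-≤ 0≤threshold h)

          0<normSq-b : 0# < normSq b
          0<normSq-b = <-≤-trans (*-pos 0<B 0<βN) (≤-reflexive (β-spec sN))

          num≉0 : ¬ (normSq num ≈ 0#)
          num≉0 = <⇒≉ (<-≤-trans (*-pos (*-pos (*-pos 0<δ*δ 0<δ*δ) 0<normSq-b) (*-pos 0<A 0<A)) n≥)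

          0<g : 0# < g
          0<g = n≉0⇒0<g num≉0

          den≉0 : ¬ (normSq den ≈ 0#)
          den≉0 = n≉0⇒d≉0 num≉0

        -- Here the second hypothesis makes `den` nonzero, as `0# < β M` forces Ψ_M ≠ 0; then |den|²
        -- ≤ B g excludes g = 0.
        case-ii : ∣ numerator ∣ < threshold →
          δ * Ψᵣ N * ∣ Ψ₁ M ∣ ≤ ∣ Ψ₁ N *ᶜ Ψ₂ M N -ᶜ Ψ₁ M *ᶜ Ψ₂ N N ∣ →
          Conclusion ×
          (∀ α → β (M ⊕ α · N) - β M ≤ δ ^ 2 * (β N / β M)) ×
          δ ^ 2 * (β N / β M) ≤ δ ^ 2
        case-ii (h , _) k = conclusion 0<g den≉0
          -- By maximality only the gain at `α₁` has to be bounded; `gain-upper` is used with e =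
          -- δ².
          , (λ α → ≤-trans (+-monoˡ-≤ (- β M) (maximal 0<g den≉0 α))
              (≤-resp-≈ refl (*-congʳ (sym δ²≈))
                (gain-upper 0<g (g*V≈t 0<g den≉0) {δ * δ} 0<δ*δ
                  (≤-resp-≈ ∣numerator∣ threshold² (square-mono-≤ (∣∣-nonneg numerator) h)) d≥)))
          , ≤-resp-≈ refl (*-identityʳ _)
              (*-monoˡ-≤ (≤-resp-≈ refl (sym δ²≈) (proj₁ 0<δ*δ))
                (*-cancelˡ-≤ 0<βM (≤-resp-≈ (sym (*-/-cancel (β N) (<⇒≉ 0<βM))) (sym (*-identityʳ (β M))) βN≤βM)))
          where
          z : ℂ
          z = Ψ₁ N *ᶜ Ψ₂ M N -ᶜ Ψ₁ M *ᶜ Ψ₂ N N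

          ∣z∣² : ∣ z ∣ * ∣ z ∣ ≈ normSq den
          ∣z∣² = trans (∣∣*∣∣ z) (trans (normSq-cong {z} {b *ᶜ c -ᶜ a *ᶜ ofReal B}
              ( +-congˡ (-‿cong (+-congˡ (-‿cong (*-congˡ im≈0)))) , +-congˡ (-‿cong (+-congʳ (*-congˡ im≈0)))))
            normSq-den)
            where im≈0 = im-Ψ₂≈0 L sN

          d≥ : δ * δ * (B * B) * normSq a ≤ normSq den
          d≥ = ≤-resp-≈
            (trans (solve 3 (λ δ B x → δ :* B :* x :* (δ :* B :* x) := δ :* δ :* (B :* B) :* (x :* x)) refl
              δ B ∣ a ∣)
              (*-congˡ (∣∣*∣∣ a))) ∣z∣²
            (square-mono-≤ (*-nonneg (*-nonneg (proj₁ 0<δ) (proj₁ 0<B)) (∣∣-nonneg a)) k)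

          0<den : 0# < normSq den
          0<den = <-≤-trans (*-pos (*-pos 0<δ*δ (*-pos 0<B 0<B))
            (<-≤-trans (*-pos 0<A 0<βM) (≤-reflexive (β-spec sM)))) d≥

          den≉0 : ¬ (normSq den ≈ 0#)
          den≉0 = <⇒≉ 0<den

          0<g : 0# < g
          0<g = ≤∧≉⇒< 0≤g λ g≈0 → den≉0 (antisym
            (≤-trans (den≤B*g (<⇒≉ 0<B) (proj₁ 0<B) normSq≤q) (≤-reflexive (trans (*-congˡ g≈0) (zeroʳ B))))
            (normSq-nonneg den))

-- From the convergence hypotheses to means, and the combination of both cases.

corollary2p8 : (em : ExcludedMiddle 0ℓ) (𝓡 : CompleteOrderedField) →
    let open Complex em 𝓡 in
    (G : Set) (L : G → ℂ) (w : G → ℝ) →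
    (∀ π → 0# ≤ w π) →
    ¬ (∀ π → w π ≈ 0#) →
    let open Weighted w L in
    Summable (λ π → ofReal (w π)) →
    (δ : ℝ) → 0# < δ → δ < 1# / (1# + 1#) →
    (M N : G → ℂ) →
    SquareSummable M → SquareSummable N →
    ¬ (Ψ₁ M *ᶜ Ψ₂ N N ≈ᶜ 0ᶜ) →
    β N ≤ β M → 0# < β N →
    let open Maximum M N in
    ( δ ^ 2 * ∣ Ψ₁ N ∣ * Ψᵣ M ≤ ∣ conj (Ψ₁ M) *ᶜ Ψ₂ M N -ᶜ conj (Ψ₁ N) *ᶜ Ψ₂ M M ∣ →
    Conclusion × δ ^ 4 * β N ≤ β (M ⊕ α₁ · N) - β M )
    ×
    ( ∣ conj (Ψ₁ M) *ᶜ Ψ₂ M N -ᶜ conj (Ψ₁ N) *ᶜ Ψ₂ M M ∣ < δ ^ 2 * ∣ Ψ₁ N ∣ * Ψᵣ M →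
    δ * Ψᵣ N * ∣ Ψ₁ M ∣ ≤ ∣ Ψ₁ N *ᶜ Ψ₂ M N -ᶜ Ψ₁ M *ᶜ Ψ₂ N N ∣ →
    Conclusion ×
    (∀ α → β (M ⊕ α · N) - β M ≤ δ ^ 2 * (β N / β M)) ×
    δ ^ 2 * (β N / β M) ≤ δ ^ 2 )
corollary2p8 em 𝓡 G L w w-nonneg w≉0 w-summable δ 0<δ _ M N sM sN _ βN≤βM 0<βN =
  case-i {M} {N} mean-M mean-N βN≤βM 0<βN 0<δ , case-ii {M} {N} mean-M mean-N βN≤βM 0<βN 0<δ
  where
  open Complex em 𝓡
  open OrderedField em 𝓡 using (≤∧≉⇒<; antisym; ≤-resp-≈)
  open RealSums em 𝓡 using (HasSumᵣ; HasSumᵣ-nonneg; term≤sum)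
  open ComplexNumbers em 𝓡 using (HasSum⇒re)

  W : ℝ
  W = re (proj₁ w-summable)

  w-sum : HasSumᵣ w W
  w-sum = HasSum⇒re (proj₂ w-summable)

  -- Each weight is at most the total, so a zero total would make `w` vanish identically.
  0<W : 0# < W
  0<W = ≤∧≉⇒< (HasSumᵣ-nonneg w-nonneg w-sum) λ W≈0 →
    w≉0 λ π → antisym (≤-resp-≈ refl W≈0 (term≤sum w-nonneg w-sum π)) (w-nonneg π)

  open Means em 𝓡 w w-nonneg w-sum 0<W using (SquareMean; SquareSummable⇒SquareMean)
  open Theorem em 𝓡 L w w-nonneg w-sum 0<W using (case-i; case-ii)

  mean-M : SquareMean L M
  mean-M = SquareSummable⇒SquareMean L {M} sM

  mean-N : SquareMean L N
  mean-N = SquareSummable⇒SquareMean L {N} sN
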